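{- Let $\mathcal{C}$ be a robust hereditary graph class for which $\beta_{\mathcal{C}}$ is finite. Then for every integer $d\ge 1$, \[ \beta_{\mathcal{C}}(d)=\begin{cases}2^{d-1}+1 & \text{if } \beta_{\mathcal{C}}=1,\\ (\beta_{\mathcal{C}}-1)2^d+1 & \text{if } \beta_{\mathcal{C}}\ge 2.\end{cases} \]
   Context: All graphs are finite, simple and undirected. $\mathrm{OPT}(G)$ is the minimum vertex cover size of $G$. A set $Y\subseteq V(G)$ is a blocking set of $G$ if no minimum vertex cover of $G$ contains $Y$; it is minimal if no proper subset of $Y$ is a blocking set. $\beta(G)$ is the maximum size of a minimal blocking set of $G$; $\beta_{\mathcal{C}}=\max_{G\in\mathcal{C}}\beta(G)$ (or $\infty$ if unbounded). A class is robust if it is closed under disjoint union and under removal of connected components; hereditary if closed under vertex deletion. The elimination distance of $G$ to $\mathcal{C}$ is $\mathrm{ed}_{\mathcal{C}}(G)=0$ if $G\in\mathcal{C}$; $\min_{v\in V(G)}\mathrm{ed}_{\mathcal{C}}(G-v)+1$ if $G\notin\mathcal{C}$ and $G$ is connected; and $\max_i \mathrm{ed}_{\mathcal{C}}(G_i)$ if $G\notin\mathcal{C}$ has connected components $G_1,\dots,G_t$, $t\ge2$. $\beta_{\mathcal{C}}(d)=\max\{\beta(G): \mathrm{ed}_{\mathcal{C}}(G)\le d\}$. -}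

module Defs where

open import Data.Nat using (ℕ; zero; suc; _≤_; _≥_)
open import Data.Bool using (Bool; true; false)
open import Data.Fin using (Fin)
open import Data.Fin.Subset using (Subset; _∈_; _∉_; _⊆_; _⊂_; ∣_∣; ∁; ⁅_⁆; ⊤)
open import Data.Product using (Σ; ∃; _×_; _,_)
open import Data.Sum using (_⊎_)
open import Relation.Nullary using (¬_)
open import Relation.Binary.PropositionalEquality using (_≡_)
open import Function.Definitions using (Injective)

record Graph : Set where
  field
    n      : ℕ
    adj    : Fin n → Fin n → Bool
    sym    : ∀ i j → adj i j ≡ adj j i
    irrefl : ∀ i → adj i i ≡ false
open Graph public

V : Graph → Set
V G = Fin (n G)

Edge : (G : Graph) → V G → V G → Set
Edge G u v = adj G u v ≡ true

GraphClass : Set₁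
GraphClass = Graph → Set

IsInduced : (H G : Graph) → Subset (n G) → Set
IsInduced H G S =
  Σ (V H → V G) λ f →
    Injective _≡_ _≡_ f
    × (∀ i → f i ∈ S)
    × (∀ v → v ∈ S → ∃ λ i → f i ≡ v)
    × (∀ i j → adj H i j ≡ adj G (f i) (f j))

data Reach (G : Graph) : V G → V G → Set where
  here : ∀ {u} → Reach G u u
  step : ∀ {u v w} → Edge G u v → Reach G v w → Reach G u w

Connected : Graph → Set
Connected G = (1 ≤ n G) × (∀ u v → Reach G u v)

-- S is a union of connected components (closed under adjacency).
ClosedUnderAdj : (G : Graph) → Subset (n G) → Set
ClosedUnderAdj G S = ∀ u v → u ∈ S → Edge G u v → v ∈ S

IsComponent : (G : Graph) → Subset (n G) → Set
IsComponent G S =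
  (∃ λ v → v ∈ S) × ClosedUnderAdj G S × (∀ u v → u ∈ S → v ∈ S → Reach G u v)

IsDisjointUnion : (K G H : Graph) → Set
IsDisjointUnion K G H =
  Σ (Subset (n K)) λ S →
    (∀ u v → u ∈ S → v ∉ S → adj K u v ≡ false)
    × IsInduced G K S × IsInduced H K (∁ S)

-- Graph classes are closed under isomorphism (standard convention).
IsoClosed : GraphClass → Set
IsoClosed C = ∀ G H → C G → IsInduced H G ⊤ → C H

Hereditary : GraphClass → Set
Hereditary C = ∀ G H (v : V G) → C G → IsInduced H G (∁ ⁅ v ⁆) → C H

Robust : GraphClass → Set
Robust C =
  (∀ K G H → C G → C H → IsDisjointUnion K G H → C K)
  × (∀ G H (S : Subset (n G)) → C G → ClosedUnderAdj G S → IsInduced H G (∁ S) → C H)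

IsVC : (G : Graph) → Subset (n G) → Set
IsVC G S = ∀ u v → Edge G u v → u ∈ S ⊎ v ∈ S

IsMinVC : (G : Graph) → Subset (n G) → Set
IsMinVC G S = IsVC G S × (∀ T → IsVC G T → ∣ S ∣ ≤ ∣ T ∣)

IsBlocking : (G : Graph) → Subset (n G) → Set
IsBlocking G Y = ∀ S → IsMinVC G S → ¬ (Y ⊆ S)

IsMinimalBlocking : (G : Graph) → Subset (n G) → Set
IsMinimalBlocking G Y = IsBlocking G Y × (∀ Z → Z ⊂ Y → ¬ IsBlocking G Z)

BetaLe : Graph → ℕ → Set
BetaLe G k = ∀ Y → IsMinimalBlocking G Y → ∣ Y ∣ ≤ k

BetaAttained : Graph → ℕ → Set
BetaAttained G k = Σ (Subset (n G)) λ Y → IsMinimalBlocking G Y × ∣ Y ∣ ≡ k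

-- β(G) = k  (max of an empty set taken to be 0)
BetaIs : Graph → ℕ → Set
BetaIs G k = BetaLe G k × (k ≡ 0 ⊎ BetaAttained G k)

-- β_C = b  (supremum over the class, attained; finite)
ClassBetaIs : GraphClass → ℕ → Set
ClassBetaIs C b =
  (∀ G → C G → BetaLe G b) × (b ≡ 0 ⊎ Σ Graph λ G → C G × BetaAttained G b)

data EdLe (C : GraphClass) : ℕ → Graph → Set where
  base  : ∀ {d G} → C G → EdLe C d G
  del   : ∀ {d G} → Connected G → (v : V G) (H : Graph) →
          IsInduced H G (∁ ⁅ v ⁆) → EdLe C d H → EdLe C (suc d) G
  comps : ∀ {d G} → 1 ≤ n G → ¬ Connected G →
          (∀ S → IsComponent G S → ∀ H → IsInduced H G S → EdLe C d H) →
          EdLe C d G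

EdBetaIs : GraphClass → ℕ → ℕ → Set
EdBetaIs C d k =
  (∀ G → EdLe C d G → BetaLe G k)
  × (k ≡ 0 ⊎ Σ Graph λ G → EdLe C d G × BetaAttained G k)

{-# OPTIONS --safe #-}
module Submission where

open import Defs
open import Data.Bool using (Bool; true; false)
import Data.Bool.Properties as Bool
open import Data.Empty using (⊥-elim)
open import Data.Fin using (Fin; zero; suc; fromℕ<; splitAt; _↑ˡ_; _↑ʳ_)
open import Data.Fin.Properties using (splitAt-↑ˡ; splitAt-↑ʳ; splitAt⁻¹-↑ˡ; splitAt⁻¹-↑ʳ; ↑ˡ-injective; ↑ʳ-injective; suc-injective; injective⇒≤; any?; all?; ¬Fin0) renaming (_≟_ to _≟ᶠ_)
open import Data.Fin.Subset
open import Data.Fin.Subset.Properties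
open import Data.Nat using (ℕ; zero; suc; _≤_; _<_; _+_; _*_; _∸_; _^_; _⊔_; z≤n; s≤s; s≤s⁻¹; pred; _≤?_)
open import Data.Nat.Properties hiding (suc-injective; _≟_)
open import Data.Nat.Solver using (module +-*-Solver)
open import Data.Product using (Σ; ∃; _×_; _,_; proj₁; proj₂)
open import Data.Sum using (_⊎_; inj₁; inj₂; [_,_]; [_,_]′)
import Data.Sum as Sum
import Data.Vec as Vec
open import Data.Vec using ([]; _∷_; _++_; here; there; lookup; tabulate)
open import Data.Vec.Properties using ([]=⇒lookup; lookup⇒[]=; lookup∘tabulate)
open import Function using (_∘_; id)
open import Relation.Binary.PropositionalEquality using (_≡_; refl; trans; cong; cong₂; subst; subst₂) renaming (sym to ≡-sym)
open import Relation.Nullary using (¬_; Dec; yes; no; does; contradiction)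
open import Relation.Nullary.Decidable using (_×-dec_; _⊎-dec_; _→-dec_; ¬?; dec-true)

-- Upper bound. Let G - v and its induced subgraphs have minimal blocking sets of size at most
-- k ≥ 2, and let Y be a minimal blocking set of G. If v ∈ Y, then Y - v need only contain one
-- blocking set of G - v, so |Y| ≤ k + 1. If v ∉ Y, then Y contains a blocking set Z of G - v
-- (against covers using v), and Y ∪ N(v) costs two extra vertices in G - v (against covers
-- avoiding v), which is witnessed by Z and a set W ⊆ Y ∪ N(v) with |W| ≤ k. By minimality
-- Y = Z ∪ (W ∩ Y), which has at most 2k - 1 elements unless W ⊆ Y; in that case exchanging the
-- roles of Z and N(v) gives |Y| ≤ k. A minimal blocking set lies in a single component, so taking
-- components does not change the bound. Hence k - 1 at most doubles with every deletion (and
-- k = 1 goes to 2).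
--
-- Lower bound. Doubling is attained by two copies of a connected graph and an apex, starting
-- from a component of a graph in the class, or from a single edge if β = 1.

-- Finite subsets

setOf : ∀ {m} {P : Fin m → Set} → (∀ x → Dec (P x)) → Subset m
setOf P? = tabulate (does ∘ P?)

∈-setOf⁺ : ∀ {m} {P : Fin m → Set} (P? : ∀ x → Dec (P x)) {x} → P x → x ∈ setOf P?
∈-setOf⁺ P? {x} px = lookup⇒[]= x _ (trans (lookup∘tabulate (does ∘ P?) x) (dec-true (P? x) px))

∈-setOf⁻ : ∀ {m} {P : Fin m → Set} (P? : ∀ x → Dec (P x)) {x} → x ∈ setOf P? → P x
∈-setOf⁻ P? {x} x∈ with P? x | trans (≡-sym (lookup∘tabulate (does ∘ P?) x)) ([]=⇒lookup x∈)
... | yes px | _ = px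
... | no _ | ()

⊈⇒∃ : ∀ {m} (p q : Subset m) → ¬ p ⊆ q → ∃ λ x → x ∈ p × x ∉ q
⊈⇒∃ p q p⊈q with any? (λ x → (x ∈? p) ×-dec ¬? (x ∈? q))
... | yes w = w
... | no ¬w = ⊥-elim (p⊈q sub)
  where
  sub : p ⊆ q
  sub {x} x∈p with x ∈? q
  ... | yes x∈q = x∈q
  ... | no x∉q = ⊥-elim (¬w (x , x∈p , x∉q))

∪-lub : ∀ {m} {p q r : Subset m} → p ⊆ r → q ⊆ r → p ∪ q ⊆ r
∪-lub {p = p} {q} p⊆r q⊆r x∈ = [ p⊆r , q⊆r ] (x∈p∪q⁻ p q x∈)

∈-∪ˡ : ∀ {m} {p q : Subset m} → p ⊆ p ∪ q
∈-∪ˡ x∈p = x∈p∪q⁺ (inj₁ x∈p)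

∈-∪ʳ : ∀ {m} {p q : Subset m} → q ⊆ p ∪ q
∈-∪ʳ x∈q = x∈p∪q⁺ (inj₂ x∈q)

∪-monoʳ : ∀ {m} {p q r : Subset m} → q ⊆ r → p ∪ q ⊆ p ∪ r
∪-monoʳ q⊆r = ∪-lub ∈-∪ˡ (∈-∪ʳ ∘ q⊆r)

x∉p-x : ∀ {m} (p : Subset m) x → x ∉ p - x
x∉p-x (_ ∷ p) zero ()
x∉p-x (_ ∷ p) (suc x) (there x∈) = x∉p-x p x x∈

⊆-minus : ∀ {m} {p q : Subset m} {x} → p ⊆ q → x ∉ p → p ⊆ q - x
⊆-minus {x = x} p⊆q x∉p {y} y∈p = x∈p∧x≢y⇒x∈p-y (p⊆q y∈p) λ where refl → x∉p y∈p

∣p∪q∣≤∣p∣+∣q∣ : ∀ {m} (p q : Subset m) → ∣ p ∪ q ∣ ≤ ∣ p ∣ + ∣ q ∣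
∣p∪q∣≤∣p∣+∣q∣ [] [] = z≤n
∣p∪q∣≤∣p∣+∣q∣ (inside ∷ p) (inside ∷ q) =
  s≤s (≤-trans (∣p∪q∣≤∣p∣+∣q∣ p q) (+-monoʳ-≤ ∣ p ∣ (n≤1+n _)))
∣p∪q∣≤∣p∣+∣q∣ (inside ∷ p) (outside ∷ q) = s≤s (∣p∪q∣≤∣p∣+∣q∣ p q)
∣p∪q∣≤∣p∣+∣q∣ (outside ∷ p) (inside ∷ q) =
  ≤-trans (s≤s (∣p∪q∣≤∣p∣+∣q∣ p q)) (≤-reflexive (≡-sym (+-suc ∣ p ∣ ∣ q ∣)))
∣p∪q∣≤∣p∣+∣q∣ (outside ∷ p) (outside ∷ q) = ∣p∪q∣≤∣p∣+∣q∣ p q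

∣p∪⁅x⁆∣≤1+∣p∣ : ∀ {m} (p : Subset m) x → ∣ p ∪ ⁅ x ⁆ ∣ ≤ suc ∣ p ∣
∣p∪⁅x⁆∣≤1+∣p∣ p x = ≤-trans (∣p∪q∣≤∣p∣+∣q∣ p ⁅ x ⁆)
  (≤-reflexive (trans (cong (∣ p ∣ +_) (∣⁅x⁆∣≡1 x)) (+-comm ∣ p ∣ 1)))

∣p∩q∣+∣p∩∁q∣ : ∀ {m} (p q : Subset m) → ∣ p ∩ q ∣ + ∣ p ∩ ∁ q ∣ ≡ ∣ p ∣
∣p∩q∣+∣p∩∁q∣ [] [] = refl
∣p∩q∣+∣p∩∁q∣ (inside ∷ p) (inside ∷ q) = cong suc (∣p∩q∣+∣p∩∁q∣ p q)
∣p∩q∣+∣p∩∁q∣ (inside ∷ p) (outside ∷ q) =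
  trans (+-suc ∣ p ∩ q ∣ ∣ p ∩ ∁ q ∣) (cong suc (∣p∩q∣+∣p∩∁q∣ p q))
∣p∩q∣+∣p∩∁q∣ (outside ∷ p) (inside ∷ q) = ∣p∩q∣+∣p∩∁q∣ p q
∣p∩q∣+∣p∩∁q∣ (outside ∷ p) (outside ∷ q) = ∣p∩q∣+∣p∩∁q∣ p q

x∈p⇒1+∣p-x∣≡∣p∣ : ∀ {m} {p : Subset m} {x} → x ∈ p → suc ∣ p - x ∣ ≡ ∣ p ∣
x∈p⇒1+∣p-x∣≡∣p∣ {p = p} {x} x∈p = ≤-antisym (x∈p⇒∣p-x∣<∣p∣ x∈p)
  (≤-trans (p⊆q⇒∣p∣≤∣q∣ restore) (∣p∪⁅x⁆∣≤1+∣p∣ (p - x) x))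
  where
  restore : p ⊆ (p - x) ∪ ⁅ x ⁆
  restore {y} y∈p with y ≟ᶠ x
  ... | yes refl = ∈-∪ʳ (x∈⁅x⁆ x)
  ... | no y≢x = ∈-∪ˡ (x∈p∧x≢y⇒x∈p-y y∈p y≢x)

-- Enumerations, preimages and images of subsets

enum : ∀ {m} (p : Subset m) → Fin ∣ p ∣ → Fin m
enum (inside ∷ p) zero = zero
enum (inside ∷ p) (suc i) = suc (enum p i)
enum (outside ∷ p) i = suc (enum p i)

enum-injective : ∀ {m} (p : Subset m) {i j} → enum p i ≡ enum p j → i ≡ j
enum-injective (inside ∷ p) {zero} {zero} _ = refl
enum-injective (inside ∷ p) {suc i} {suc j} eq = cong suc (enum-injective p (suc-injective eq))
enum-injective (outside ∷ p) eq = enum-injective p (suc-injective eq)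

enum-∈ : ∀ {m} (p : Subset m) i → enum p i ∈ p
enum-∈ (inside ∷ p) zero = here
enum-∈ (inside ∷ p) (suc i) = there (enum-∈ p i)
enum-∈ (outside ∷ p) i = there (enum-∈ p i)

enum-surjective : ∀ {m} (p : Subset m) x → x ∈ p → ∃ λ i → enum p i ≡ x
enum-surjective (inside ∷ p) zero here = zero , refl
enum-surjective (inside ∷ p) (suc x) (there x∈p) =
  let i , eq = enum-surjective p x x∈p in suc i , cong suc eq
enum-surjective (outside ∷ p) (suc x) (there x∈p) =
  let i , eq = enum-surjective p x x∈p in i , cong suc eq

injection⇒∣∣≤ : ∀ {l m} (f : Fin l → Fin m) (p : Subset l) (q : Subset m) →
  (∀ {x y} → f x ≡ f y → x ≡ y) → (∀ {x} → x ∈ p → f x ∈ q) → ∣ p ∣ ≤ ∣ q ∣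
injection⇒∣∣≤ f p q f-inj f-maps = injective⇒≤ {f = index} λ {i} {j} eq →
  enum-injective p (f-inj (trans (≡-sym (index-spec i)) (trans (cong (enum q) eq) (index-spec j))))
  where
  preimageOf : ∀ i → ∃ λ j → enum q j ≡ f (enum p i)
  preimageOf i = enum-surjective q _ (f-maps (enum-∈ p i))
  index = proj₁ ∘ preimageOf
  index-spec = proj₂ ∘ preimageOf

infixr 8 _⁻¹[_]
_⁻¹[_] : ∀ {l m} → (Fin l → Fin m) → Subset m → Subset l
f ⁻¹[ p ] = setOf (λ i → f i ∈? p)

image : ∀ {l m} → (Fin l → Fin m) → Subset l → Subset m
image f p = setOf (λ x → any? (λ i → (i ∈? p) ×-dec (f i ≟ᶠ x)))

module _ {l m} (f : Fin l → Fin m) where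

  ∈-⁻¹⁺ : ∀ {p i} → f i ∈ p → i ∈ f ⁻¹[ p ]
  ∈-⁻¹⁺ {p} = ∈-setOf⁺ (λ i → f i ∈? p)

  ∈-⁻¹⁻ : ∀ {p i} → i ∈ f ⁻¹[ p ] → f i ∈ p
  ∈-⁻¹⁻ {p} = ∈-setOf⁻ (λ i → f i ∈? p)

  ∈-image⁺ : ∀ {p i} → i ∈ p → f i ∈ image f p
  ∈-image⁺ {p} i∈p = ∈-setOf⁺ (λ x → any? (λ i → (i ∈? p) ×-dec (f i ≟ᶠ x))) (_ , i∈p , refl)

  ∈-image⁻ : ∀ {p x} → x ∈ image f p → ∃ λ i → i ∈ p × f i ≡ x
  ∈-image⁻ {p} = ∈-setOf⁻ (λ x → any? (λ i → (i ∈? p) ×-dec (f i ≟ᶠ x)))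

  module _ (f-inj : ∀ {x y} → f x ≡ f y → x ≡ y) where

    ∣image∣≤ : ∀ p → ∣ image f p ∣ ≤ ∣ p ∣
    ∣image∣≤ p = injective⇒≤ {f = index} λ {i} {j} eq →
      enum-injective (image f p) (trans (≡-sym (index-spec i)) (trans (cong (f ∘ enum p) eq) (index-spec j)))
      where
      preimageOf : ∀ i → ∃ λ j → f (enum p j) ≡ enum (image f p) i
      preimageOf i =
        let x , x∈p , fx≡ = ∈-image⁻ (enum-∈ (image f p) i)
            j , j≡ = enum-surjective p x x∈p
        in j , trans (cong f j≡) fx≡
      index = proj₁ ∘ preimageOf
      index-spec = proj₂ ∘ preimageOf

    ∣⁻¹∣≤ : ∀ p → ∣ f ⁻¹[ p ] ∣ ≤ ∣ p ∣
    ∣⁻¹∣≤ p = injection⇒∣∣≤ f (f ⁻¹[ p ]) p f-inj ∈-⁻¹⁻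

-- Vertex covers

-- Lower bounds on cover sizes stand in for minimum covers: with m the optimum, Y is blocking
-- exactly when `Forces G Y (suc m)` holds.
Forces : (G : Graph) → Subset (n G) → ℕ → Set
Forces G A m = ∀ T → IsVC G T → A ⊆ T → m ≤ ∣ T ∣

Forces-mono : ∀ G {A B m} → A ⊆ B → Forces G A m → Forces G B m
Forces-mono G A⊆B fA T vc B⊆T = fA T vc (B⊆T ∘ A⊆B)

isVC? : ∀ G T → Dec (IsVC G T)
isVC? G T = all? λ u → all? λ v → (adj G u v Bool.≟ true) →-dec ((u ∈? T) ⊎-dec (v ∈? T))

CoverWithin : (G : Graph) → Subset (n G) → ℕ → Set
CoverWithin G A m = ∃ λ T → IsVC G T × A ⊆ T × ∣ T ∣ ≤ m

-- All subsets can be searched, so the failure of a lower bound yields an actual cover. The later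
-- case splits on cover sizes rest on this dichotomy.
forces-or-cover : ∀ G A m → Forces G A (suc m) ⊎ CoverWithin G A m
forces-or-cover G A m with anySubset? (λ T → isVC? G T ×-dec ((A ⊆? T) ×-dec (∣ T ∣ ≤? m)))
... | yes w = inj₂ w
... | no ¬w = inj₁ λ T vc A⊆T → ≰⇒> λ T≤m → ¬w (T , vc , (λ {x} → A⊆T {x}) , T≤m)

forces? : ∀ G A m → Dec (Forces G A (suc m))
forces? G A m with forces-or-cover G A m
... | inj₁ f = yes f
... | inj₂ (T , vc , A⊆T , T≤m) = no λ f → <⇒≱ (f T vc A⊆T) T≤m

optimum : ∀ G A → ∃ λ m → Forces G A m × CoverWithin G A m
optimum G A = search (n G) (⊤ , (λ _ _ _ → inj₁ ∈⊤) , (λ {x} _ → ∈⊤ {x = x}) , ∣p∣≤n ⊤)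
  where
  search : ∀ m → CoverWithin G A m → ∃ λ m → Forces G A m × CoverWithin G A m
  search zero c = zero , (λ _ _ _ → z≤n) , c
  search (suc m) c with forces-or-cover G A m
  ... | inj₁ f = suc m , f , c
  ... | inj₂ c′ = search m c′

-- Says β(G - A) ≤ k without mentioning G - A, whose covers are those of G containing A,
-- with A removed. Quantifying over A covers all induced subgraphs at once.
Reducible : (G : Graph) → Subset (n G) → ℕ → Set
Reducible G A k = ∀ m X → Forces G A m → Forces G (A ∪ X) (suc m) →
  ∃ λ W → W ⊆ X × ∣ W ∣ ≤ k × Forces G (A ∪ W) (suc m)

Reducible-mono : ∀ {G A k l} → k ≤ l → Reducible G A k → Reducible G A l
Reducible-mono k≤l r m X fA fX =
  let W , W⊆X , W≤k , fW = r m X fA fX in W , (λ {x} → W⊆X {x}) , ≤-trans W≤k k≤l , fW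

-- When m is the least size of a cover containing A, such a Y is a minimal blocking set of G - A.
-- Minimality concludes `Y ⊆ Z` so that every forcing subset of Y bounds the size of Y directly.
record Critical (G : Graph) (A Y : Subset (n G)) (m : ℕ) : Set where
  field
    forces  : Forces G (A ∪ Y) (suc m)
    minimal : ∀ Z → Z ⊆ Y → Forces G (A ∪ Z) (suc m) → Y ⊆ Z

-- Elements are deleted while the bound survives. Once no single deletion is possible, monotonicity
-- of `Forces` excludes all proper subsets at once.
critical-subset : ∀ G A X m → Forces G (A ∪ X) (suc m) → ∃ λ Y → Y ⊆ X × Critical G A Y m
critical-subset G A X m f = shrink ∣ X ∣ X ≤-refl f
  where
  shrink : ∀ c X → ∣ X ∣ ≤ c → Forces G (A ∪ X) (suc m) → ∃ λ Y → Y ⊆ X × Critical G A Y m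
  shrink c X X≤c f with any? (λ x → (x ∈? X) ×-dec forces? G (A ∪ (X - x)) m)
  shrink zero X X≤c f | yes (x , x∈X , _) =
    contradiction (≤-trans (x∈p⇒∣p-x∣<∣p∣ x∈X) X≤c) λ ()
  shrink (suc c) X X≤c f | yes (x , x∈X , f′) =
    let Y , Y⊆ , crit = shrink c (X - x) (s≤s⁻¹ (≤-trans (x∈p⇒∣p-x∣<∣p∣ x∈X) X≤c)) f′
    in Y , (λ y∈Y → p─q⊆p X ⁅ x ⁆ (Y⊆ y∈Y)) , crit
  shrink c X X≤c f | no none = X , (λ x∈ → x∈) , record
    { forces = f
    ; minimal = λ Z Z⊆X fZ {x} x∈X → keep Z (λ {x} → Z⊆X {x}) fZ x∈X (x ∈? Z) }
    where
    keep : ∀ Z → Z ⊆ X → Forces G (A ∪ Z) (suc m) → ∀ {x} → x ∈ X → Dec (x ∈ Z) → x ∈ Z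
    keep Z Z⊆X fZ x∈X (yes x∈Z) = x∈Z
    keep Z Z⊆X fZ x∈X (no x∉Z) =
      ⊥-elim (none (_ , x∈X , Forces-mono G (∪-monoʳ (⊆-minus (λ {x} → Z⊆X {x}) x∉Z)) fZ))

Reducible-if-critical-≤ : ∀ {G A k} →
  (∀ m Y → Forces G A m → Critical G A Y m → ∣ Y ∣ ≤ k) → Reducible G A k
Reducible-if-critical-≤ {G} {A} bound m X fA fX =
  let Y , Y⊆X , crit = critical-subset G A X m fX
  in Y , (λ {x} → Y⊆X {x}) , bound m Y fA crit , Critical.forces crit

critical-≤ : ∀ {G A k m Y} → Reducible G A k → Forces G A m → Critical G A Y m → ∣ Y ∣ ≤ k
critical-≤ r fA crit =
  let W , W⊆Y , W≤k , fW = r _ _ fA (Critical.forces crit)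
  in ≤-trans (p⊆q⇒∣p∣≤∣q∣ (Critical.minimal crit W W⊆Y fW)) W≤k

-- If Y - y still forced the larger size, minimality would place y in Y - y.
critical-tight : ∀ {G A Y m y} → Critical G A Y m → y ∈ Y → CoverWithin G (A ∪ (Y - y)) m
critical-tight {G} {A} {Y} {m} {y} crit y∈Y with forces-or-cover G (A ∪ (Y - y)) m
... | inj₁ f = ⊥-elim (x∉p-x Y y (Critical.minimal crit (Y - y) (p─q⊆p Y ⁅ y ⁆) f y∈Y))
... | inj₂ c = c

-- A subset of Y that misses y lies in Y - y, so the cheap cover for Y - y refutes its bound.
tight⇒critical : ∀ {G A Y m} → Forces G (A ∪ Y) (suc m) →
  (∀ {y} → y ∈ Y → CoverWithin G (A ∪ (Y - y)) m) → Critical G A Y m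
tight⇒critical {G} {A} {Y} {m} f tight = record { forces = f ; minimal = minimal }
  where
  minimal : ∀ Z → Z ⊆ Y → Forces G (A ∪ Z) (suc m) → Y ⊆ Z
  minimal Z Z⊆Y fZ {y} y∈Y with y ∈? Z
  ... | yes y∈Z = y∈Z
  ... | no y∉Z =
    let T , vc , A∪⊆T , T≤m = tight y∈Y
    in ⊥-elim (<⇒≱ (fZ T vc λ x∈ → A∪⊆T (∪-monoʳ (⊆-minus (λ {x} → Z⊆Y {x}) y∉Z) x∈)) T≤m)

-- The optimum serves as m: covers of size at most m are then the minimum covers, so a blocking set
-- is one that pushes every cover containing it above m.
minimalBlocking⇒critical : ∀ {G Y} → IsMinimalBlocking G Y → ∃ λ m →
  Forces G ⊥ m × Critical G ⊥ Y m
minimalBlocking⇒critical {G} {Y} (blocking , minimal) with optimum G ⊥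
... | m , f , T , vc , _ , T≤m = m , f , record { forces = forces ; minimal = minimal′ }
  where
  isMin : ∀ S → IsVC G S → ∣ S ∣ ≤ m → IsMinVC G S
  isMin S vcS S≤m = vcS , λ U vcU → ≤-trans S≤m (f U vcU ⊥⊆)
  forces : Forces G (⊥ ∪ Y) (suc m)
  forces S vcS Y⊆S = ≰⇒> λ S≤m → blocking S (isMin S vcS S≤m) (λ x∈ → Y⊆S (∈-∪ʳ x∈))
  minimal′ : ∀ Z → Z ⊆ Y → Forces G (⊥ ∪ Z) (suc m) → Y ⊆ Z
  minimal′ Z Z⊆Y fZ with Y ⊆? Z
  ... | yes Y⊆Z = Y⊆Z
  ... | no Y⊈Z = ⊥-elim (minimal Z ((λ {x} → Z⊆Y {x}) , ⊈⇒∃ Y Z Y⊈Z) λ S (vcS , S-min) Z⊆S →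
    <⇒≱ (fZ S vcS (∪-lub ⊥⊆ (λ {x} → Z⊆S {x}))) (≤-trans (S-min T vc) T≤m))

critical⇒minimalBlocking : ∀ {G Y m} → Forces G ⊥ m → CoverWithin G ⊥ m →
  Critical G ⊥ Y m → IsMinimalBlocking G Y
critical⇒minimalBlocking {G} {Y} {m} f (T , vc , _ , T≤m) crit = blocking , minimal
  where
  blocking : IsBlocking G Y
  blocking S (vcS , S-min) Y⊆S =
    <⇒≱ (Critical.forces crit S vcS (∪-lub ⊥⊆ (λ {x} → Y⊆S {x}))) (≤-trans (S-min T vc) T≤m)
  minimal : ∀ Z → Z ⊂ Y → ¬ IsBlocking G Z
  minimal Z (Z⊆Y , x , x∈Y , x∉Z) Z-blocking = x∉Z (Critical.minimal crit Z Z⊆Y forces x∈Y)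
    where
    forces : Forces G (⊥ ∪ Z) (suc m)
    forces S vcS Z⊆S = ≰⇒> λ S≤m →
      Z-blocking S (vcS , λ U vcU → ≤-trans S≤m (f U vcU ⊥⊆)) (λ x∈ → Z⊆S (∈-∪ʳ x∈))

BetaLe⇒Reducible : ∀ {G k} → BetaLe G k → Reducible G ⊥ k
BetaLe⇒Reducible {G} {k} le m X f fX with forces-or-cover G ⊥ m
-- Here m lies strictly below the optimum, so the empty set already forces `suc m`.
... | inj₁ f′ = ⊥ , ⊥⊆ , subst (_≤ k) (≡-sym (∣⊥∣≡0 (n G))) z≤n , Forces-mono G ⊥⊆ f′
... | inj₂ c =
  let Y , Y⊆X , crit = critical-subset G ⊥ X m fX
  in Y , Y⊆X , le Y (critical⇒minimalBlocking f c crit) , Critical.forces crit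

Reducible⇒BetaLe : ∀ {G k} → Reducible G ⊥ k → BetaLe G k
Reducible⇒BetaLe {G} r Y mb = let m , f , crit = minimalBlocking⇒critical mb in critical-≤ {G} {⊥} r f crit

-- Adding a vertex

N : (G : Graph) → V G → Subset (n G)
N G v = tabulate (adj G v)

∈-N⁺ : ∀ G {v x} → Edge G v x → x ∈ N G v
∈-N⁺ G {v} {x} e = lookup⇒[]= x _ (trans (lookup∘tabulate (adj G v) x) e)

∈-N⁻ : ∀ G {v x} → x ∈ N G v → Edge G v x
∈-N⁻ G {v} {x} x∈ = trans (≡-sym (lookup∘tabulate (adj G v) x)) ([]=⇒lookup x∈)

Edge-sym : ∀ G {u v} → Edge G u v → Edge G v u
Edge-sym G {u} {v} e = trans (sym G v u) e

IsVC-mono : ∀ {G S T} → S ⊆ T → IsVC G S → IsVC G T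
IsVC-mono S⊆T vc u v e = Sum.map S⊆T S⊆T (vc u v e)

-- A cover containing v and its neighbours stays a cover without v.
Forces-N : ∀ G {v A m} → v ∉ A → Forces G A m → Forces G ((A ∪ ⁅ v ⁆) ∪ N G v) (suc m)
Forces-N G {v} {A} v∉A fA T vc ⊆T =
  ≤-trans (s≤s (fA (T - v) vc′ (⊆-minus (⊆T ∘ ∈-∪ˡ ∘ ∈-∪ˡ) v∉A)))
          (x∈p⇒∣p-x∣<∣p∣ (⊆T (∈-∪ˡ (∈-∪ʳ (x∈⁅x⁆ v)))))
  where
  drop : ∀ {x y} → x ∈ T → Edge G x y → x ∈ T - v ⊎ y ∈ T - v
  drop {x} {y} x∈T e with x ≟ᶠ v
  ... | no x≢v = inj₁ (x∈p∧x≢y⇒x∈p-y x∈T x≢v)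
  ... | yes refl = inj₂ (x∈p∧x≢y⇒x∈p-y (⊆T (∈-∪ʳ (∈-N⁺ G e)))
    λ where refl → contradiction (trans (≡-sym e) (irrefl G v)) λ ())
  vc′ : IsVC G (T - v)
  vc′ x y e with vc x y e
  ... | inj₁ x∈T = drop x∈T e
  ... | inj₂ y∈T = Sum.swap (drop y∈T (Edge-sym G e))

-- A cover avoiding v contains N(v), and adding v to it costs one vertex; this accounts for `suc m`
-- in the second hypothesis.
Forces-cases : ∀ G {v A m} → Forces G (A ∪ ⁅ v ⁆) m →
  Forces G ((A ∪ ⁅ v ⁆) ∪ N G v) (suc m) → Forces G A m
Forces-cases G {v} {A} fv fN T vc A⊆T with v ∈? T
... | yes v∈T = fv T vc (∪-lub (λ {x} → A⊆T {x}) λ x∈ → subst (_∈ T) (≡-sym (x∈⁅y⁆⇒x≡y v x∈)) v∈T)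
... | no v∉T = s≤s⁻¹ (≤-trans
    (fN (T ∪ ⁅ v ⁆) (IsVC-mono {G} ∈-∪ˡ vc) (∪-lub (∪-lub (∈-∪ˡ ∘ A⊆T) ∈-∪ʳ) (∈-∪ˡ ∘ N⊆T)))
    (∣p∪⁅x⁆∣≤1+∣p∣ T v))
  where
  N⊆T : N G v ⊆ T
  N⊆T {x} x∈ = [ (λ v∈T → ⊥-elim (v∉T v∈T)) , id ]′ (vc v x (∈-N⁻ G x∈))

Forces-remove : ∀ G {A y m} → Forces G (A ∪ ⁅ y ⁆) (suc m) → Forces G A m
Forces-remove G {A} {y} f T vc A⊆T = s≤s⁻¹ (≤-trans
  (f (T ∪ ⁅ y ⁆) (IsVC-mono {G} ∈-∪ˡ vc) (∪-lub (∈-∪ˡ ∘ A⊆T) ∈-∪ʳ)) (∣p∪⁅x⁆∣≤1+∣p∣ T y))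

-- The first term comes from critical sets containing v, the second from those avoiding v. It equals
-- 2k - 1 for k at least 2, so k - 1 doubles, and equals 2 for k = 1.
bump : ℕ → ℕ
bump k = suc k ⊔ (k + (k ∸ 1))

k≤bump : ∀ k → k ≤ bump k
k≤bump k = ≤-trans (n≤1+n k) (m≤m⊔n (suc k) (k + (k ∸ 1)))

-- Requiring v ∈ A expresses, inside G, that G - v and all its induced subgraphs have minimal
-- blocking sets of size at most k.
module _ (G : Graph) (v : V G) (k : ℕ) (red : ∀ A → v ∈ A → Reducible G A k) where

  private
    v∈∪v : ∀ {A} → v ∈ A ∪ ⁅ v ⁆
    v∈∪v = ∈-∪ʳ (x∈⁅x⁆ v)

  -- A subset W of Y that blocks the covers containing v blocks outright once v joins it, so
  -- minimality leaves nothing in Y beyond W and v.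
  critical-≤-bump-in : ∀ {A m Y} → Forces G A m → Critical G A Y m → v ∈ Y → ∣ Y ∣ ≤ suc k
  critical-≤-bump-in {A} {m} {Y} fA crit v∈Y
    with red (A ∪ ⁅ v ⁆) v∈∪v m Y (Forces-mono G ∈-∪ˡ fA)
             (Forces-mono G (∪-lub (∈-∪ˡ ∘ ∈-∪ˡ) ∈-∪ʳ) (Critical.forces crit))
  ... | W , W⊆Y , W≤k , fW = ≤-trans (p⊆q⇒∣p∣≤∣q∣ Y⊆) (≤-trans (∣p∪⁅x⁆∣≤1+∣p∣ W v) (s≤s W≤k))
    where
    Y⊆ : Y ⊆ W ∪ ⁅ v ⁆
    Y⊆ = Critical.minimal crit (W ∪ ⁅ v ⁆)
      (∪-lub (λ {x} → W⊆Y {x}) λ x∈ → subst (_∈ Y) (≡-sym (x∈⁅y⁆⇒x≡y v x∈)) v∈Y)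
      (Forces-mono G (∪-lub (∪-lub ∈-∪ˡ (∈-∪ʳ ∘ ∈-∪ʳ)) (∈-∪ʳ ∘ ∈-∪ˡ)) fW)

  -- If Y alone already costs two extra vertices next to v, then N(v) can play the role of
  -- the first of the two blocking sets, and the second one must be all of Y.
  critical-≤-if-doubly-forced : ∀ {A m Y} → Forces G A m → Critical G A Y m → v ∉ A →
    Forces G ((A ∪ ⁅ v ⁆) ∪ Y) (suc (suc m)) → ∣ Y ∣ ≤ k
  critical-≤-if-doubly-forced {A} {m} {Y} fA crit v∉A fY
    with red ((A ∪ ⁅ v ⁆) ∪ N G v) (∈-∪ˡ v∈∪v) (suc m) Y (Forces-N G v∉A fA)
             (Forces-mono G (∪-lub (∈-∪ˡ ∘ ∈-∪ˡ) ∈-∪ʳ) fY)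
  ... | W , W⊆Y , W≤k , fW with Y ⊆? W
  ... | yes Y⊆W = ≤-trans (p⊆q⇒∣p∣≤∣q∣ Y⊆W) W≤k
  ... | no Y⊈W with ⊈⇒∃ Y W Y⊈W
  ... | y , y∈Y , y∉W = ⊥-elim (x∉p-x Y y (Critical.minimal crit (Y - y) (p─q⊆p Y ⁅ y ⁆) forces y∈Y))
    where
    restore : Y ⊆ (Y - y) ∪ ⁅ y ⁆
    restore {x} x∈Y with x ≟ᶠ y
    ... | yes refl = ∈-∪ʳ (x∈⁅x⁆ y)
    ... | no x≢y = ∈-∪ˡ (x∈p∧x≢y⇒x∈p-y x∈Y x≢y)
    forces : Forces G (A ∪ (Y - y)) (suc m)
    -- For covers containing v, dropping y lowers the bound m + 2 by at most one. Covers avoiding v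
    -- contain N(v), next to which W, a subset of Y - y, already forces m + 2.
    forces = Forces-cases G
      (Forces-remove G {y = y} (Forces-mono G (∪-lub (∪-lub (∈-∪ˡ ∘ ∈-∪ˡ ∘ ∈-∪ˡ) (∈-∪ˡ ∘ ∈-∪ʳ))
        (∪-lub (∈-∪ˡ ∘ ∈-∪ˡ ∘ ∈-∪ʳ) ∈-∪ʳ ∘ restore)) fY))
      (Forces-mono G (∪-lub (∪-lub (∪-lub (∈-∪ˡ ∘ ∈-∪ˡ ∘ ∈-∪ˡ) (∈-∪ˡ ∘ ∈-∪ʳ)) ∈-∪ʳ)
        (∈-∪ˡ ∘ ∈-∪ˡ ∘ ∈-∪ʳ ∘ ⊆-minus (λ {x} → W⊆Y {x}) y∉W)) fW)

  critical-≤-bump-out : ∀ {A m Y} → Forces G A m → Critical G A Y m → v ∉ A → v ∉ Y →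
    ∣ Y ∣ ≤ k ⊔ (k + (k ∸ 1))
  critical-≤-bump-out {A} {m} {Y} fA crit v∉A v∉Y
    with red (A ∪ ⁅ v ⁆) v∈∪v m Y (Forces-mono G ∈-∪ˡ fA)
             (Forces-mono G (∪-lub (∈-∪ˡ ∘ ∈-∪ˡ) ∈-∪ʳ) (Critical.forces crit))
  ... | Z , Z⊆Y , Z≤k , fZ
    -- The lower bound is now m + 1, forced by Z, and `Forces-N` raises the cost of Y together with
    -- v and N(v) to m + 2.
    with red ((A ∪ ⁅ v ⁆) ∪ Z) (∈-∪ˡ v∈∪v) (suc m) (Y ∪ N G v) fZ
             (Forces-mono G (∪-lub (∪-lub (∪-lub (∈-∪ˡ ∘ ∈-∪ˡ ∘ ∈-∪ˡ) (∈-∪ʳ ∘ ∈-∪ˡ)) (∈-∪ˡ ∘ ∈-∪ˡ ∘ ∈-∪ʳ))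
                (∈-∪ʳ ∘ ∈-∪ʳ)) (Forces-N G v∉A∪Y (Critical.forces crit)))
    where
    v∉A∪Y : v ∉ A ∪ Y
    v∉A∪Y v∈ = [ v∉A , v∉Y ]′ (x∈p∪q⁻ A Y v∈)
  ... | W , W⊆ , W≤k , fW with W ⊆? Y
  -- Z and W then both lie in Y, so Y alone forces m + 2 beside v.
  ... | yes W⊆Y = ≤-trans
    (critical-≤-if-doubly-forced fA crit v∉A
      (Forces-mono G (∪-lub (∪-lub ∈-∪ˡ (∈-∪ʳ ∘ Z⊆Y)) (∈-∪ʳ ∘ W⊆Y)) fW))
    (m≤m⊔n k _)
  ... | no W⊈Y = ≤-trans
    (≤-trans (p⊆q⇒∣p∣≤∣q∣ Y⊆) (≤-trans (∣p∪q∣≤∣p∣+∣q∣ Z (W ∩ Y)) (+-mono-≤ Z≤k W∩Y≤k-1)))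
    (m≤n⊔m k _)
    where
    W∩Y≤k-1 : ∣ W ∩ Y ∣ ≤ k ∸ 1
    W∩Y≤k-1 =
      let x , x∈W , x∉Y = ⊈⇒∃ W Y W⊈Y
      in ∸-monoˡ-≤ {suc ∣ W ∩ Y ∣} {k} 1 (≤-trans (p⊂q⇒∣p∣<∣q∣
           (p∩q⊆p W Y , x , x∈W , λ x∈ → x∉Y (p∩q⊆q W Y x∈))) W≤k)
    W⊆Y′ : ∀ {x} → x ∈ W → x ∈ ((A ∪ (Z ∪ (W ∩ Y))) ∪ ⁅ v ⁆) ∪ N G v
    W⊆Y′ x∈W = [ (λ x∈Y → ∈-∪ˡ (∈-∪ˡ (∈-∪ʳ (∈-∪ʳ (x∈p∩q⁺ (x∈W , x∈Y)))))) , ∈-∪ʳ ]′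
      (x∈p∪q⁻ Y (N G v) (W⊆ x∈W))
    Y⊆ : Y ⊆ Z ∪ (W ∩ Y)
    -- Z handles the covers containing v; for covers avoiding v, the part of W outside Y comes for
    -- free inside N(v).
    Y⊆ = Critical.minimal crit (Z ∪ (W ∩ Y)) (∪-lub (λ {x} → Z⊆Y {x}) (p∩q⊆q W Y)) (Forces-cases G
      (Forces-mono G (∪-lub (∪-lub (∈-∪ˡ ∘ ∈-∪ˡ) ∈-∪ʳ) (∈-∪ˡ ∘ ∈-∪ʳ ∘ ∈-∪ˡ)) fZ)
      (Forces-mono G (∪-lub (∪-lub (∪-lub (∈-∪ˡ ∘ ∈-∪ˡ ∘ ∈-∪ˡ) (∈-∪ˡ ∘ ∈-∪ʳ))
        (∈-∪ˡ ∘ ∈-∪ˡ ∘ ∈-∪ʳ ∘ ∈-∪ˡ)) W⊆Y′) fW))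

  Reducible-bump : ∀ A → Reducible G A (bump k)
  Reducible-bump A with v ∈? A
  ... | yes v∈A = Reducible-mono {G} {A} (k≤bump k) (red A v∈A)
  ... | no v∉A = Reducible-if-critical-≤ λ m Y fA crit → bound fA crit (v ∈? Y)
    where
    bound : ∀ {m Y} → Forces G A m → Critical G A Y m → Dec (v ∈ Y) → ∣ Y ∣ ≤ bump k
    bound fA crit (yes v∈Y) = ≤-trans (critical-≤-bump-in fA crit v∈Y) (m≤m⊔n (suc k) (k + (k ∸ 1)))
    bound fA crit (no v∉Y) =
      ≤-trans (critical-≤-bump-out fA crit v∉A v∉Y) (⊔-monoˡ-≤ (k + (k ∸ 1)) (n≤1+n k))

-- Induced subgraphs

induced : (G : Graph) → Subset (n G) → Graph
induced G S = record
  { n = ∣ S ∣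
  ; adj = λ i j → adj G (enum S i) (enum S j)
  ; sym = λ i j → sym G (enum S i) (enum S j)
  ; irrefl = λ i → irrefl G (enum S i)
  }

induced-isInduced : ∀ G S → IsInduced (induced G S) G S
induced-isInduced G S =
  enum S , enum-injective S , enum-∈ S , enum-surjective S , λ _ _ → refl

module _ {H G : Graph} {S : Subset (n G)} (ind : IsInduced H G S) where

  private
    f = proj₁ ind
    f-inj : ∀ {i j} → f i ≡ f j → i ≡ j
    f-inj = proj₁ (proj₂ ind)
    f-∈ = proj₁ (proj₂ (proj₂ ind))
    f-onto = proj₁ (proj₂ (proj₂ (proj₂ ind)))
    f-adj = proj₂ (proj₂ (proj₂ (proj₂ ind)))

  IsVC-restrict : ∀ {T} → IsVC G T → IsVC H (f ⁻¹[ T ])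
  IsVC-restrict vc i j e =
    Sum.map (∈-⁻¹⁺ f) (∈-⁻¹⁺ f) (vc (f i) (f j) (trans (≡-sym (f-adj i j)) e))

  -- Edges with an end outside S are covered by taking the whole complement of S.
  IsVC-extend : ∀ {T} → IsVC H T → IsVC G (image f T ∪ ∁ S)
  IsVC-extend {T} vc u v e with u ∈? S | v ∈? S
  ... | no u∉S | _ = inj₁ (∈-∪ʳ (x∉p⇒x∈∁p u∉S))
  ... | yes _ | no v∉S = inj₂ (∈-∪ʳ (x∉p⇒x∈∁p v∉S))
  ... | yes u∈S | yes v∈S with f-onto u u∈S | f-onto v v∈S
  ... | i , refl | j , refl =
    Sum.map (∈-∪ˡ ∘ ∈-image⁺ f) (∈-∪ˡ ∘ ∈-image⁺ f) (vc i j (trans (f-adj i j) e))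

  ∣restrict∣ : ∀ T → ∁ S ⊆ T → ∣ f ⁻¹[ T ] ∣ + ∣ ∁ S ∣ ≤ ∣ T ∣
  ∣restrict∣ T ∁S⊆T = ≤-trans
    (+-mono-≤ (injection⇒∣∣≤ f (f ⁻¹[ T ]) (T ∩ S) f-inj λ {i} i∈ → x∈p∩q⁺ (∈-⁻¹⁻ f i∈ , f-∈ i))
              (p⊆q⇒∣p∣≤∣q∣ λ x∈ → x∈p∩q⁺ (∁S⊆T x∈ , x∈)))
    (≤-reflexive (∣p∩q∣+∣p∩∁q∣ T S))

  ∣extend∣ : ∀ T → ∣ image f T ∪ ∁ S ∣ ≤ ∣ T ∣ + ∣ ∁ S ∣
  ∣extend∣ T = ≤-trans (∣p∪q∣≤∣p∣+∣q∣ (image f T) (∁ S)) (+-monoˡ-≤ ∣ ∁ S ∣ (∣image∣≤ f f-inj T))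

  ⊆-extend : ∀ {A T} → f ⁻¹[ A ] ⊆ T → A ⊆ image f T ∪ ∁ S
  ⊆-extend A⊆T {x} x∈A with x ∈? S
  ... | no x∉S = ∈-∪ʳ (x∉p⇒x∈∁p x∉S)
  ... | yes x∈S with f-onto x x∈S
  ... | i , refl = ∈-∪ˡ (∈-image⁺ f (A⊆T (∈-⁻¹⁺ f x∈A)))

  Forces-restrict : ∀ {A B m} → f ⁻¹[ A ] ⊆ B → Forces G A (m + ∣ ∁ S ∣) → Forces H B m
  Forces-restrict A⊆B fA T vc B⊆T = +-cancelʳ-≤ ∣ ∁ S ∣ _ _ (≤-trans
    (fA _ (IsVC-extend vc) (⊆-extend (λ x∈ → B⊆T (A⊆B x∈)))) (∣extend∣ T))

  Forces-extend : ∀ {A B m} → ∁ S ⊆ A → (∀ {i} → i ∈ B → f i ∈ A) →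
    Forces H B m → Forces G A (m + ∣ ∁ S ∣)
  Forces-extend ∁S⊆A B⊆A fB T vc A⊆T = ≤-trans
    (+-monoˡ-≤ ∣ ∁ S ∣ (fB _ (IsVC-restrict vc) λ i∈B → ∈-⁻¹⁺ f (A⊆T (B⊆A i∈B))))
    (∣restrict∣ T (λ x∈ → A⊆T (∁S⊆A x∈)))

  -- Covers of G containing the complement of S are covers of H with a fixed set of extra vertices,
  -- so the bounds only shift by `∣ ∁ S ∣`.
  Reducible-extend : ∀ {A k} → ∁ S ⊆ A → Reducible H (f ⁻¹[ A ]) k → Reducible G A k
  Reducible-extend {A} {k} ∁S⊆A red m X fA fX with ∣ ∁ S ∣ ≤? m
  -- The complement of S alone has more than m vertices, so the empty set suffices. In the other
  -- case the subtraction from m is exact.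
  ... | no c≰m = ⊥ , ⊥⊆ , subst (_≤ k) (≡-sym (∣⊥∣≡0 (n G))) z≤n , λ T _ A⊆T →
    ≤-trans (≰⇒> c≰m) (p⊆q⇒∣p∣≤∣q∣ λ x∈ → A⊆T (∈-∪ˡ (∁S⊆A x∈)))
  ... | yes c≤m =
    let W , W⊆ , W≤k , fW = red (m ∸ ∣ ∁ S ∣) (f ⁻¹[ X ])
          (Forces-restrict (λ x∈ → x∈) (subst (Forces G A) (≡-sym m≡) fA))
          (Forces-restrict ∪⊆ (subst (Forces G (A ∪ X)) (≡-sym (cong suc m≡)) fX))
    in image f W
     , (λ x∈ → let i , i∈W , eq = ∈-image⁻ f x∈ in subst (_∈ X) eq (∈-⁻¹⁻ f (W⊆ i∈W)))
     , ≤-trans (∣image∣≤ f f-inj W) W≤k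
     , subst (Forces G (A ∪ image f W)) (cong suc m≡)
         (Forces-extend (∈-∪ˡ ∘ ∁S⊆A)
           (λ i∈ → [ (λ i∈A → ∈-∪ˡ (∈-⁻¹⁻ f i∈A)) , (λ i∈W → ∈-∪ʳ (∈-image⁺ f i∈W)) ]′
             (x∈p∪q⁻ (f ⁻¹[ A ]) W i∈)) fW)
    where
    m≡ : (m ∸ ∣ ∁ S ∣) + ∣ ∁ S ∣ ≡ m
    m≡ = m∸n+n≡m c≤m
    ∪⊆ : f ⁻¹[ A ∪ X ] ⊆ f ⁻¹[ A ] ∪ f ⁻¹[ X ]
    ∪⊆ i∈ = x∈p∪q⁺ (Sum.map (∈-⁻¹⁺ f) (∈-⁻¹⁺ f) (x∈p∪q⁻ A X (∈-⁻¹⁻ f i∈)))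

  -- The two hypotheses on A together say that A is exactly the complement of S, that is, G - A is
  -- H.
  critical-restrict : ∀ {A Y c} → ∁ S ⊆ A → Empty (f ⁻¹[ A ]) → Critical G A Y (c + ∣ ∁ S ∣) →
    Critical H ⊥ (f ⁻¹[ Y ]) c
  critical-restrict {A} {Y} {c} ∁S⊆A empty crit = tight⇒critical
    (Forces-restrict (λ i∈ → [ (λ i∈A → ⊥-elim (empty (_ , ∈-⁻¹⁺ f i∈A))) , ∈-∪ʳ ∘ ∈-⁻¹⁺ f ]′
      (x∈p∪q⁻ A Y (∈-⁻¹⁻ f i∈))) (Critical.forces crit)) tight
    where
    tight : ∀ {i} → i ∈ f ⁻¹[ Y ] → CoverWithin H (⊥ ∪ (f ⁻¹[ Y ] - i)) c
    tight {i} i∈ with critical-tight crit (∈-⁻¹⁻ f i∈)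
    ... | T , vc , T⊇ , T≤ = f ⁻¹[ T ] , IsVC-restrict vc
      , ∪-lub ⊥⊆ (λ {j} j∈ → ∈-⁻¹⁺ f (T⊇ (∈-∪ʳ (x∈p∧x≢y⇒x∈p-y
          (∈-⁻¹⁻ f (p─q⊆p (f ⁻¹[ Y ]) ⁅ i ⁆ j∈))
          λ eq → x∉p-x (f ⁻¹[ Y ]) i (subst (_∈ f ⁻¹[ Y ] - i) (f-inj eq) j∈)))))
      , +-cancelʳ-≤ ∣ ∁ S ∣ _ _ (≤-trans (∣restrict∣ T (λ x∈ → T⊇ (∈-∪ˡ (∁S⊆A x∈)))) T≤)

  ∣⁻¹∣≡ : ∀ {Y} → Y ⊆ S → ∣ f ⁻¹[ Y ] ∣ ≡ ∣ Y ∣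
  ∣⁻¹∣≡ {Y} Y⊆S = ≤-antisym (∣⁻¹∣≤ f f-inj Y)
    (≤-trans (p⊆q⇒∣p∣≤∣q∣ Y⊆) (∣image∣≤ f f-inj (f ⁻¹[ Y ])))
    where
    Y⊆ : Y ⊆ image f (f ⁻¹[ Y ])
    Y⊆ {x} x∈Y with f-onto x (Y⊆S x∈Y)
    ... | i , refl = ∈-image⁺ f (∈-⁻¹⁺ f x∈Y)

  -- A path starting in a closed set never leaves it, so each of its vertices has a preimage in H.
  Reach-restrict : ClosedUnderAdj G S → ∀ {u v} → Reach G u v → ∀ i j → f i ≡ u → f j ≡ v → Reach H i j
  Reach-restrict closed here i j refl fj≡ rewrite f-inj fj≡ = here
  Reach-restrict closed (step {v = v} e p) i j refl fj≡ with f-onto v (closed (f i) v (f-∈ i) e)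
  ... | k , refl = step (trans (f-adj i k) e) (Reach-restrict closed p k j refl fj≡)

IsInduced-factor : ∀ {H G K R S} (ind : IsInduced K G R) → IsInduced H G S → S ⊆ R →
  IsInduced H K (proj₁ ind ⁻¹[ S ])
IsInduced-factor {H} {G} {K} {R} {S} (f , f-inj , f-∈ , f-onto , f-adj) (g , g-inj , g-∈ , g-onto , g-adj) S⊆R =
  h , h-inj , h-∈ , h-onto , h-adj
  where
  lift : ∀ i → ∃ λ j → f j ≡ g i
  lift i = f-onto (g i) (S⊆R (g-∈ i))
  h = proj₁ ∘ lift
  f∘h : ∀ i → f (h i) ≡ g i
  f∘h = proj₂ ∘ lift
  h-inj : ∀ {i j} → h i ≡ h j → i ≡ j
  h-inj {i} {j} eq = g-inj (trans (≡-sym (f∘h i)) (trans (cong f eq) (f∘h j)))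
  h-∈ : ∀ i → h i ∈ f ⁻¹[ S ]
  h-∈ i = ∈-⁻¹⁺ f (subst (_∈ S) (≡-sym (f∘h i)) (g-∈ i))
  h-onto : ∀ j → j ∈ f ⁻¹[ S ] → ∃ λ i → h i ≡ j
  h-onto j j∈ = let i , eq = g-onto (f j) (∈-⁻¹⁻ f j∈) in i , f-inj (trans (f∘h i) eq)
  h-adj : ∀ i j → adj H i j ≡ adj K (h i) (h j)
  h-adj i j = trans (g-adj i j) (trans (≡-sym (cong₂ (adj G) (f∘h i) (f∘h j))) (≡-sym (f-adj (h i) (h j))))

-- Vertices outside S are deleted one at a time; when none is left, H is isomorphic to the remaining
-- graph.
hereditary-induced : ∀ {C} → IsoClosed C → Hereditary C →
  ∀ {G H S} → C G → IsInduced H G S → C H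
hereditary-induced {C} iso her {G} {H} {S} = go (n G) G S ≤-refl
  where
  go : ∀ c G S → n G ≤ c → C G → IsInduced H G S → C H
  go c G S G≤c cG ind with ⊤ ⊆? S
  ... | yes ⊤⊆S = iso G H cG (subst (IsInduced H G) (⊆-antisym ⊆⊤ ⊤⊆S) ind)
  ... | no ⊤⊈S with ⊈⇒∃ ⊤ S ⊤⊈S
  go zero G S G≤0 cG ind | no _ | v , _ = ⊥-elim (¬Fin0 (subst Fin (n≤0⇒n≡0 G≤0) v))
  go (suc c) G S G≤c cG ind | no _ | v , _ , v∉S =
    let K = induced G (∁ ⁅ v ⁆)
        indK = induced-isInduced G (∁ ⁅ v ⁆)
        ind′ = IsInduced-factor {H} {G} {K} indK ind
                      (λ {x} x∈S → x∉p⇒x∈∁p (x≢y⇒x∉⁅y⁆ λ where refl → v∉S x∈S))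
    in go c K _ (s≤s⁻¹ (≤-trans K<G G≤c)) (her G K v cG indK) ind′
    where
    K<G : ∣ ∁ ⁅ v ⁆ ∣ < n G
    K<G = subst (∣ ∁ ⁅ v ⁆ ∣ <_) (∣⊤∣≡n (n G))
      (p⊂q⇒∣p∣<∣q∣ (⊆⊤ , v , ∈⊤ , λ v∈ → x∈∁p⇒x∉p v∈ (x∈⁅x⁆ v)))

-- Components

Reach-trans : ∀ {G u v w} → Reach G u v → Reach G v w → Reach G u w
Reach-trans here q = q
Reach-trans (step e p) q = step e (Reach-trans p q)

Reach-sym : ∀ {G u v} → Reach G u v → Reach G v u
Reach-sym here = here
Reach-sym {G} (step e p) = Reach-trans (Reach-sym p) (step (Edge-sym G e) here)

closed? : ∀ G S → ClosedUnderAdj G S ⊎ ∃ λ u → ∃ λ v → u ∈ S × Edge G u v × v ∉ S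
closed? G S with any? (λ u → any? (λ v → (u ∈? S) ×-dec ((adj G u v Bool.≟ true) ×-dec ¬? (v ∈? S))))
... | yes w = inj₂ w
... | no ¬w = inj₁ closed
  where
  closed : ClosedUnderAdj G S
  closed u v u∈S e with v ∈? S
  ... | yes v∈S = v∈S
  ... | no v∉S = ⊥-elim (¬w (u , v , u∈S , e , v∉S))

component : ∀ G u → ∃ λ K → u ∈ K × IsComponent G K
component G u =
  let K , u∈K , closed , reach = grow (n G) ⁅ u ⁆ (x∈⁅x⁆ u)
        (λ x∈ → subst (Reach G u) (≡-sym (x∈⁅y⁆⇒x≡y u x∈)) here) (m≤n+m (n G) ∣ ⁅ u ⁆ ∣)
  in K , u∈K , (u , u∈K) , closed , λ x y x∈K y∈K → Reach-trans (Reach-sym (reach x∈K)) (reach y∈K)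
  where
  grow : ∀ c K → u ∈ K → (∀ {x} → x ∈ K → Reach G u x) → n G ≤ ∣ K ∣ + c →
    ∃ λ K → u ∈ K × ClosedUnderAdj G K × (∀ {x} → x ∈ K → Reach G u x)
  grow c K u∈K reach n≤ with closed? G K
  ... | inj₁ closed = K , u∈K , closed , reach
  -- The counter bounds the number of vertices missing from K, so at zero K is everything and no
  -- edge can leave it.
  grow zero K u∈K reach n≤ | inj₂ (x , y , x∈K , e , y∉K) = ⊥-elim (y∉K (subst (y ∈_) (≡-sym K≡⊤) ∈⊤))
    where
    K≡⊤ : K ≡ ⊤
    K≡⊤ = ∣p∣≡n⇒p≡⊤ (≤-antisym (∣p∣≤n K) (subst (n G ≤_) (+-identityʳ ∣ K ∣) n≤))
  grow (suc c) K u∈K reach n≤ | inj₂ (x , y , x∈K , e , y∉K) =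
    grow c (K ∪ ⁅ y ⁆) (∈-∪ˡ u∈K) reach′
      (≤-trans n≤ (≤-trans (≤-reflexive (+-suc ∣ K ∣ c)) (+-monoˡ-≤ c K<)))
    where
    K< : ∣ K ∣ < ∣ K ∪ ⁅ y ⁆ ∣
    K< = p⊂q⇒∣p∣<∣q∣ (∈-∪ˡ , y , ∈-∪ʳ (x∈⁅x⁆ y) , y∉K)
    reach′ : ∀ {z} → z ∈ K ∪ ⁅ y ⁆ → Reach G u z
    reach′ z∈ with x∈p∪q⁻ K ⁅ y ⁆ z∈
    ... | inj₁ z∈K = reach z∈K
    ... | inj₂ z∈y rewrite x∈⁅y⁆⇒x≡y y z∈y = Reach-trans (reach x∈K) (step e here)

-- Splicing two covers along a union of components

splice : ∀ {m} → Subset m → Subset m → Subset m → Subset m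
splice K S T = (S ∩ K) ∪ (T ∩ ∁ K)

∈-splice-in : ∀ {m} {K S T : Subset m} {x} → x ∈ K → x ∈ S → x ∈ splice K S T
∈-splice-in x∈K x∈S = ∈-∪ˡ (x∈p∩q⁺ (x∈S , x∈K))

∈-splice-out : ∀ {m} {K S T : Subset m} {x} → x ∉ K → x ∈ T → x ∈ splice K S T
∈-splice-out x∉K x∈T = ∈-∪ʳ (x∈p∩q⁺ (x∈T , x∉p⇒x∈∁p x∉K))

⊆-splice : ∀ {m} {A K S T : Subset m} → (∀ {x} → x ∈ A → x ∈ K → x ∈ S) →
  (∀ {x} → x ∈ A → x ∉ K → x ∈ T) → A ⊆ splice K S T
⊆-splice {K = K} inS inT {x} x∈A with x ∈? K
... | yes x∈K = ∈-splice-in x∈K (inS x∈A x∈K)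
... | no x∉K = ∈-splice-out x∉K (inT x∈A x∉K)

∣splice∣≤ : ∀ {m} (K S T : Subset m) → ∣ splice K S T ∣ ≤ ∣ S ∩ K ∣ + ∣ T ∩ ∁ K ∣
∣splice∣≤ K S T = ∣p∪q∣≤∣p∣+∣q∣ (S ∩ K) (T ∩ ∁ K)

-- Each of the four pieces of S and T inside and outside K is used by exactly one of the two
-- splices.
∣splice∣+∣splice∣ : ∀ {m} (K S T : Subset m) →
  ∣ splice K S T ∣ + ∣ splice K T S ∣ ≤ ∣ S ∣ + ∣ T ∣
∣splice∣+∣splice∣ K S T = begin
  ∣ splice K S T ∣ + ∣ splice K T S ∣ ≤⟨ +-mono-≤ (∣splice∣≤ K S T) (∣splice∣≤ K T S) ⟩
  (s₁ + t₂) + (t₁ + s₂)               ≡⟨ shuffle s₁ t₂ t₁ s₂ ⟩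
  (s₁ + s₂) + (t₁ + t₂)               ≡⟨ cong₂ _+_ (∣p∩q∣+∣p∩∁q∣ S K) (∣p∩q∣+∣p∩∁q∣ T K) ⟩
  ∣ S ∣ + ∣ T ∣                        ∎
  where
  open ≤-Reasoning
  s₁ = ∣ S ∩ K ∣
  s₂ = ∣ S ∩ ∁ K ∣
  t₁ = ∣ T ∩ K ∣
  t₂ = ∣ T ∩ ∁ K ∣
  shuffle : ∀ a b c d → (a + b) + (c + d) ≡ (a + d) + (c + b)
  shuffle = solve 4 (λ a b c d → (a :+ b) :+ (c :+ d) := (a :+ d) :+ (c :+ b)) refl
    where
    open +-*-Solver

module _ (G : Graph) {K : Subset (n G)} (closed : ClosedUnderAdj G K) where

  -- No edge joins K to its complement, so each edge meets only one of the two covers.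
  IsVC-splice : ∀ {S T} → IsVC G S → IsVC G T → IsVC G (splice K S T)
  IsVC-splice vcS vcT u v e with u ∈? K
  ... | yes u∈K = Sum.map (∈-splice-in u∈K) (∈-splice-in (closed u v u∈K e)) (vcS u v e)
  ... | no u∉K = Sum.map (∈-splice-out u∉K)
    (∈-splice-out (λ v∈K → u∉K (closed v u v∈K (Edge-sym G e)))) (vcT u v e)

  -- Splicing covers for Y ∩ K and Y ─ K both ways shows that one of the two parts
  -- of a critical set already raises the cost.
  critical⊆closed : ∀ {A Y m y} → Forces G A m → Critical G A Y m → y ∈ Y → y ∈ K → Y ⊆ K
  critical⊆closed {A} {Y} {m} {y} fA crit y∈Y y∈K
    with forces-or-cover G (A ∪ (Y ∩ K)) m | forces-or-cover G (A ∪ (Y ∩ ∁ K)) m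
  ... | inj₁ f | _ = λ x∈Y → p∩q⊆q Y K (Critical.minimal crit (Y ∩ K) (p∩q⊆p Y K) f x∈Y)
  ... | _ | inj₁ f = ⊥-elim (x∈∁p⇒x∉p
    (p∩q⊆q Y (∁ K) (Critical.minimal crit (Y ∩ ∁ K) (p∩q⊆p Y (∁ K)) f y∈Y)) y∈K)
  ... | inj₂ (S , vcS , S⊇ , S≤m) | inj₂ (T , vcT , T⊇ , T≤m) = ⊥-elim (<⇒≱ big small)
    where
    small : ∣ splice K S T ∣ + ∣ splice K T S ∣ ≤ m + m
    small = ≤-trans (∣splice∣+∣splice∣ K S T) (+-mono-≤ S≤m T≤m)
    -- The first splice contains A and all of Y, the second contains A; together they exceed the 2m
    -- vertices available.
    big : suc m + m ≤ ∣ splice K S T ∣ + ∣ splice K T S ∣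
    big = +-mono-≤
      (Critical.forces crit _ (IsVC-splice vcS vcT) (∪-lub
        (⊆-splice (λ x∈A _ → S⊇ (∈-∪ˡ x∈A)) (λ x∈A _ → T⊇ (∈-∪ˡ x∈A)))
        (⊆-splice (λ x∈Y x∈K → S⊇ (∈-∪ʳ (x∈p∩q⁺ (x∈Y , x∈K))))
                  (λ x∈Y x∉K → T⊇ (∈-∪ʳ (x∈p∩q⁺ (x∈Y , x∉p⇒x∈∁p x∉K)))))))
      (fA _ (IsVC-splice vcT vcS)
        (⊆-splice (λ x∈A _ → T⊇ (∈-∪ˡ x∈A)) (λ x∈A _ → S⊇ (∈-∪ˡ x∈A))))

  -- Costs inside K and outside K are independent, as any inside part can be spliced with any
  -- outside part. Hence the outside may be replaced by the full complement of K, shifting all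
  -- bounds by the same amount.
  critical-localise : ∀ {A Y m y} → Forces G A m → Critical G A Y m → y ∈ Y → Y ⊆ K →
    ∃ λ c → Forces G (A ∪ ∁ K) (c + ∣ ∁ K ∣) × Critical G (A ∪ ∁ K) Y (c + ∣ ∁ K ∣)
  critical-localise {A} {Y} {m} {y} fA crit y∈Y Y⊆K with critical-tight crit y∈Y
  -- Tightness at y supplies a cover S containing A of size at most m. Its part inside K gives the
  -- optimum c there, and its part outside K is the filler for splicing.
  ... | S , vcS , S⊇ , S≤m = c , forces-A , tight⇒critical forces-Y tight
    where
    c = ∣ S ∩ K ∣
    r = ∣ S ∩ ∁ K ∣
    c+r≤m : c + r ≤ m
    c+r≤m = ≤-trans (≤-reflexive (∣p∩q∣+∣p∩∁q∣ S K)) S≤m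
    outside-full : ∀ {T} → A ∪ ∁ K ⊆ T → ∣ T ∩ K ∣ + ∣ ∁ K ∣ ≤ ∣ T ∣
    outside-full {T} ⊆T = ≤-trans
      (+-monoʳ-≤ ∣ T ∩ K ∣ (p⊆q⇒∣p∣≤∣q∣ λ x∈ → x∈p∩q⁺ (⊆T (∈-∪ʳ x∈) , x∈)))
      (≤-reflexive (∣p∩q∣+∣p∩∁q∣ T K))
    forces-A : Forces G (A ∪ ∁ K) (c + ∣ ∁ K ∣)
    forces-A T vcT ⊆T = ≤-trans (+-monoˡ-≤ ∣ ∁ K ∣ (+-cancelʳ-≤ r c ∣ T ∩ K ∣ (≤-trans c+r≤m
        (≤-trans (fA (splice K T S) (IsVC-splice vcT vcS)
            (⊆-splice (λ x∈A _ → ⊆T (∈-∪ˡ x∈A)) (λ x∈A _ → S⊇ (∈-∪ˡ x∈A))))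
          (∣splice∣≤ K T S)))))
      (outside-full ⊆T)
    forces-Y : Forces G ((A ∪ ∁ K) ∪ Y) (suc (c + ∣ ∁ K ∣))
    forces-Y T vcT ⊆T = ≤-trans (+-monoˡ-≤ ∣ ∁ K ∣ (+-cancelʳ-≤ r (suc c) ∣ T ∩ K ∣ (≤-trans (s≤s c+r≤m)
        (≤-trans (Critical.forces crit (splice K T S) (IsVC-splice vcT vcS)
            (∪-lub (⊆-splice (λ x∈A _ → ⊆T (∈-∪ˡ (∈-∪ˡ x∈A))) (λ x∈A _ → S⊇ (∈-∪ˡ x∈A)))
                   (⊆-splice (λ x∈Y _ → ⊆T (∈-∪ʳ x∈Y)) (λ x∈Y x∉K → ⊥-elim (x∉K (Y⊆K x∈Y))))))
          (∣splice∣≤ K T S)))))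
      (outside-full (⊆T ∘ ∈-∪ˡ))
    tight : ∀ {z} → z ∈ Y → CoverWithin G ((A ∪ ∁ K) ∪ (Y - z)) (c + ∣ ∁ K ∣)
    tight {z} z∈Y with critical-tight crit z∈Y
    ... | T , vcT , T⊇ , T≤m =
      (T ∩ K) ∪ ∁ K , IsVC-mono {G} T⊆ vcT
      , (λ x∈ → ∪-lub (∪-lub (T⊆ ∘ T⊇ ∘ ∈-∪ˡ) ∈-∪ʳ) (T⊆ ∘ T⊇ ∘ ∈-∪ʳ) x∈)
      , ≤-trans (∣p∪q∣≤∣p∣+∣q∣ (T ∩ K) (∁ K)) (+-monoˡ-≤ ∣ ∁ K ∣ T∩K≤c)
      where
      T⊆ : T ⊆ (T ∩ K) ∪ ∁ K
      T⊆ {x} x∈T with x ∈? K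
      ... | yes x∈K = ∈-∪ˡ (x∈p∩q⁺ (x∈T , x∈K))
      ... | no x∉K = ∈-∪ʳ (x∉p⇒x∈∁p x∉K)
      T∩K≤c : ∣ T ∩ K ∣ ≤ c
      T∩K≤c = +-cancelʳ-≤ ∣ T ∩ ∁ K ∣ _ _ (≤-trans (≤-reflexive (∣p∩q∣+∣p∩∁q∣ T K)) (≤-trans T≤m
        (≤-trans (fA (splice K S T) (IsVC-splice vcS vcT)
            (⊆-splice (λ x∈A _ → S⊇ (∈-∪ˡ x∈A)) (λ x∈A _ → T⊇ (∈-∪ˡ x∈A))))
          (∣splice∣≤ K S T))))

-- A nonempty critical set lies in one component K and stays critical when the complement of K joins
-- A, so the bound for K applies.
Reducible-components : ∀ {G k} → (∀ K → IsComponent G K → ∀ A → ∁ K ⊆ A → Reducible G A k) →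
  ∀ A → Reducible G A k
Reducible-components {G} {k} red A = Reducible-if-critical-≤ bound
  where
  bound : ∀ m Y → Forces G A m → Critical G A Y m → ∣ Y ∣ ≤ k
  bound m Y fA crit with nonempty? Y
  ... | no empty = subst (_≤ k) (≡-sym (trans (cong ∣_∣ (Empty-unique empty)) (∣⊥∣≡0 (n G)))) z≤n
  ... | yes (y , y∈Y) =
    let K , y∈K , comp = component G y
        closed = proj₁ (proj₂ comp)
        _ , fA′ , crit′ = critical-localise G closed fA crit y∈Y (critical⊆closed G closed fA crit y∈Y y∈K)
    in critical-≤ (red K comp (A ∪ ∁ K) ∈-∪ʳ) fA′ crit′

-- The upper bound

bumps : ℕ → ℕ → ℕ
bumps b zero = b
bumps b (suc d) = bump (bumps b d)

b≤bumps : ∀ b d → b ≤ bumps b d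
b≤bumps b zero = ≤-refl
b≤bumps b (suc d) = ≤-trans (b≤bumps b d) (k≤bump (bumps b d))

module _ {C : GraphClass} (iso : IsoClosed C) (her : Hereditary C)
         {b : ℕ} (β≤ : ∀ G → C G → BetaLe G b) where

  -- G - A is an induced subgraph, hence in the class, and the set A leaves no trace in it.
  class-Reducible : ∀ {G} → C G → ∀ A → Reducible G A b
  class-Reducible {G} cG A = Reducible-extend {induced G (∁ A)} {G} {∁ A} ind {A} ∁∁A⊆A
      (subst (λ B → Reducible (induced G (∁ A)) B b) (≡-sym (Empty-unique empty))
        (BetaLe⇒Reducible {induced G (∁ A)}
          (β≤ (induced G (∁ A)) (hereditary-induced iso her cG ind))))
    where
    ind = induced-isInduced G (∁ A)
    ∁∁A⊆A : ∁ (∁ A) ⊆ A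
    ∁∁A⊆A x∈ = x∉∁p⇒x∈p (x∈∁p⇒x∉p x∈)
    empty : Empty (enum (∁ A) ⁻¹[ A ])
    empty (i , i∈) = x∈∁p⇒x∉p (enum-∈ (∁ A) i) (∈-⁻¹⁻ (enum (∁ A)) i∈)

  -- The statement ranges over all A, and not only the empty set, because `Reducible-bump` needs the
  -- bound for every induced subgraph of G - v.
  EdLe-Reducible : ∀ {d G} → EdLe C d G → ∀ A → Reducible G A (bumps b d)
  EdLe-Reducible {d} {G} (base cG) A = Reducible-mono {G} {A} (b≤bumps b d) (class-Reducible cG A)
  EdLe-Reducible {suc d} {G} (del _ v H ind ed) A = Reducible-bump G v (bumps b d) (λ A v∈A →
    Reducible-extend {H} {G} ind {A}
      (λ x∈ → subst (_∈ A) (≡-sym (x∈⁅y⁆⇒x≡y v (x∉∁p⇒x∈p (x∈∁p⇒x∉p x∈)))) v∈A)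
      (EdLe-Reducible ed _)) A
  EdLe-Reducible {d} {G} (comps _ _ eds) A = Reducible-components {G} (λ K comp A ∁K⊆A →
    Reducible-extend {induced G K} {G} (induced-isInduced G K) {A} ∁K⊆A
      (EdLe-Reducible (eds K comp (induced G K) (induced-isInduced G K)) (enum K ⁻¹[ A ]))) A

  EdLe-BetaLe : ∀ {d G} → EdLe C d G → BetaLe G (bumps b d)
  EdLe-BetaLe {G = G} ed = Reducible⇒BetaLe {G} (EdLe-Reducible ed ⊥)

-- Closed form of the iterated bound

bump-suc : ∀ j → 1 ≤ j → bump (suc j) ≡ suc (j + j)
bump-suc j 1≤j = m≤n⇒m⊔n≡n (s≤s (+-monoˡ-≤ j 1≤j))

j*p+j*p : ∀ j p → j * p + j * p ≡ j * (p + (p + 0))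
j*p+j*p = solve 2 (λ j p → j :* p :+ j :* p := j :* (p :+ (p :+ con 0))) refl
  where
  open +-*-Solver

bumps-suc : ∀ j d → 1 ≤ j → bumps (suc j) d ≡ suc (j * 2 ^ d)
bumps-suc j zero 1≤j = cong suc (≡-sym (*-identityʳ j))
bumps-suc j (suc d) 1≤j = trans (cong bump (bumps-suc j d 1≤j))
  (trans (bump-suc (j * 2 ^ d) (*-mono-≤ 1≤j (m^n>0 2 d))) (cong suc (j*p+j*p j (2 ^ d))))

-- The first deletion takes 1 to 2 without doubling anything, which is why the exponent is d - 1
-- when β = 1.
bumps-one : ∀ d → bumps 1 (suc d) ≡ bumps 2 d
bumps-one zero = refl
bumps-one (suc d) = cong bump (bumps-one d)

-- Elimination distance is invariant under isomorphism

IsInduced-trans : ∀ {K H G S R} → IsInduced K H S → (ind : IsInduced H G R) →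
  IsInduced K G (image (proj₁ ind) S)
IsInduced-trans (g , g-inj , g-∈ , g-onto , g-adj) (f , f-inj , f-∈ , f-onto , f-adj) =
  f ∘ g , g-inj ∘ f-inj , (λ i → ∈-image⁺ f (g-∈ i))
  , (λ v v∈ → let j , j∈S , eq = ∈-image⁻ f v∈
                  i , eq′ = g-onto j j∈S
              in i , trans (cong f eq′) eq)
  , λ i j → trans (g-adj i j) (f-adj (g i) (g j))

IsInduced-refl : ∀ G → IsInduced G G ⊤
IsInduced-refl G = id , id , (λ _ → ∈⊤) , (λ v _ → v , refl) , λ _ _ → refl

IsInduced-sym : ∀ {H G} → IsInduced H G ⊤ → IsInduced G H ⊤
IsInduced-sym {H} {G} ind = subst (IsInduced G H)
  (⊆-antisym ⊆⊤ λ _ → ∈-⁻¹⁺ (proj₁ ind) ∈⊤)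
  (IsInduced-factor {G} {G} {H} ind (IsInduced-refl G) λ x∈ → x∈)

Reach-map : ∀ {G H} (f : V G → V H) → (∀ {i j} → Edge G i j → Edge H (f i) (f j)) →
  ∀ {u v} → Reach G u v → Reach H (f u) (f v)
Reach-map f f-edge here = here
Reach-map f f-edge (step e p) = step (f-edge e) (Reach-map f f-edge p)

Connected-iso : ∀ {G H} → IsInduced H G ⊤ → Connected H → Connected G
Connected-iso {G} {H} (f , f-inj , _ , f-onto , f-adj) (1≤n , reach) =
  ≤-trans 1≤n (injective⇒≤ f-inj) , reach′
  where
  reach′ : ∀ u v → Reach G u v
  reach′ u v with f-onto u ∈⊤ | f-onto v ∈⊤
  ... | i , refl | j , refl = Reach-map f (λ {i} {j} e → trans (≡-sym (f-adj i j)) e) (reach i j)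

IsComponent-iso : ∀ {G H S} (ind : IsInduced H G ⊤) → IsComponent H S →
  IsComponent G (image (proj₁ ind) S)
IsComponent-iso {G} {H} {S} (f , f-inj , _ , f-onto , f-adj) ((s , s∈S) , closed , reach) =
  (f s , ∈-image⁺ f s∈S) , closed′ , reach′
  where
  closed′ : ClosedUnderAdj G (image f S)
  closed′ u v u∈ e with ∈-image⁻ f u∈ | f-onto v ∈⊤
  ... | i , i∈S , refl | j , refl = ∈-image⁺ f (closed i j i∈S (trans (f-adj i j) e))
  reach′ : ∀ u v → u ∈ image f S → v ∈ image f S → Reach G u v
  reach′ u v u∈ v∈ with ∈-image⁻ f u∈ | ∈-image⁻ f v∈
  ... | i , i∈S , refl | j , j∈S , refl =
    Reach-map f (λ {i} {j} e → trans (≡-sym (f-adj i j)) e) (reach i j i∈S j∈S)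

-- `comps` speaks of every graph isomorphic to a component, so distances known for one copy must
-- carry over to all others.
EdLe-iso : ∀ {C} → IsoClosed C → ∀ {d G H} → IsInduced H G ⊤ → EdLe C d G → EdLe C d H
EdLe-iso iso {G = G} {H} ind (base cG) = base (iso G H cG ind)
EdLe-iso iso {G = G} {H} ind@(f , f-inj , _ , f-onto , _) (del conn v K indK ed) with f-onto v ∈⊤
... | w , refl = del (Connected-iso (IsInduced-sym {H} {G} ind) conn) w K
  (subst (IsInduced K H) (⊆-antisym
      (λ i∈ → x∉p⇒x∈∁p (x≢y⇒x∉⁅y⁆ λ where
        refl → x∈∁p⇒x∉p (∈-⁻¹⁻ f i∈) (x∈⁅x⁆ (f w))))
      (λ i∈ → ∈-⁻¹⁺ f (x∉p⇒x∈∁p (x≢y⇒x∉⁅y⁆ λ eq → x∉⁅y⁆⇒x≢y (x∈∁p⇒x∉p i∈) (f-inj eq)))))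
    (IsInduced-factor {K} {G} {H} ind indK ⊆⊤)) ed
EdLe-iso iso {G = G} {H} ind (comps 1≤n ¬conn eds) =
  comps (≤-trans 1≤n (injective⇒≤ (proj₁ (proj₂ (IsInduced-sym {H} {G} ind)))))
    (λ conn → ¬conn (Connected-iso ind conn))
    (λ S comp K indK → eds _ (IsComponent-iso ind comp) K (IsInduced-trans {K} {H} {G} indK ind))

-- Disjoint unions

∣++∣ : ∀ {l m} (p : Subset l) (q : Subset m) → ∣ p ++ q ∣ ≡ ∣ p ∣ + ∣ q ∣
∣++∣ [] q = refl
∣++∣ (inside ∷ p) q = cong suc (∣++∣ p q)
∣++∣ (outside ∷ p) q = ∣++∣ p q

∈-++ˡ⁺ : ∀ {l m} {p : Subset l} {q : Subset m} {x} → x ∈ p → x ↑ˡ m ∈ p ++ q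
∈-++ˡ⁺ here = here
∈-++ˡ⁺ (there x∈p) = there (∈-++ˡ⁺ x∈p)

∈-++ʳ⁺ : ∀ {l m} (p : Subset l) {q : Subset m} {x} → x ∈ q → l ↑ʳ x ∈ p ++ q
∈-++ʳ⁺ [] x∈q = x∈q
∈-++ʳ⁺ (_ ∷ p) x∈q = there (∈-++ʳ⁺ p x∈q)

∈-++ˡ⁻ : ∀ {l m} {p : Subset l} {q : Subset m} {x} → x ↑ˡ m ∈ p ++ q → x ∈ p
∈-++ˡ⁻ {p = _ ∷ p} {x = zero} here = here
∈-++ˡ⁻ {p = _ ∷ p} {x = suc x} (there x∈) = there (∈-++ˡ⁻ x∈)

∈-++ʳ⁻ : ∀ {l m} (p : Subset l) {q : Subset m} {x} → l ↑ʳ x ∈ p ++ q → x ∈ q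
∈-++ʳ⁻ [] x∈ = x∈
∈-++ʳ⁻ (_ ∷ p) (there x∈) = ∈-++ʳ⁻ p x∈

data Split (l m : ℕ) : Fin (l + m) → Set where
  left  : ∀ i → Split l m (i ↑ˡ m)
  right : ∀ j → Split l m (l ↑ʳ j)

split : ∀ l m x → Split l m x
split l m x with splitAt l x in eq
... | inj₁ i = subst (Split l m) (splitAt⁻¹-↑ˡ eq) (left i)
... | inj₂ j = subst (Split l m) (splitAt⁻¹-↑ʳ {l} eq) (right j)

++-⊆ : ∀ {l m} {p p′ : Subset l} {q q′ : Subset m} → p ⊆ p′ → q ⊆ q′ → p ++ q ⊆ p′ ++ q′
++-⊆ {l} {m} {p} {p′} p⊆ q⊆ {x} x∈ with split l m x
... | left i = ∈-++ˡ⁺ (p⊆ (∈-++ˡ⁻ x∈))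
... | right j = ∈-++ʳ⁺ p′ (q⊆ (∈-++ʳ⁻ p x∈))

sumAdj : (G H : Graph) → V G ⊎ V H → V G ⊎ V H → Bool
sumAdj G H (inj₁ i) (inj₁ j) = adj G i j
sumAdj G H (inj₂ i) (inj₂ j) = adj H i j
sumAdj G H _ _ = false

infixl 6 _⊕_
_⊕_ : Graph → Graph → Graph
G ⊕ H = record
  { n = n G + n H
  ; adj = λ x y → sumAdj G H (splitAt (n G) x) (splitAt (n G) y)
  ; sym = λ x y → sumAdj-sym (splitAt (n G) x) (splitAt (n G) y)
  ; irrefl = λ x → sumAdj-irrefl (splitAt (n G) x)
  }
  where
  sumAdj-sym : ∀ s t → sumAdj G H s t ≡ sumAdj G H t s
  sumAdj-sym (inj₁ i) (inj₁ j) = sym G i j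
  sumAdj-sym (inj₁ i) (inj₂ j) = refl
  sumAdj-sym (inj₂ i) (inj₁ j) = refl
  sumAdj-sym (inj₂ i) (inj₂ j) = sym H i j
  sumAdj-irrefl : ∀ s → sumAdj G H s s ≡ false
  sumAdj-irrefl (inj₁ i) = irrefl G i
  sumAdj-irrefl (inj₂ i) = irrefl H i

module _ (G H : Graph) where

  private
    inl : V G → V (G ⊕ H)
    inl i = i ↑ˡ n H
    inr : V H → V (G ⊕ H)
    inr j = n G ↑ʳ j

  adj-inl : ∀ i j → adj G i j ≡ adj (G ⊕ H) (inl i) (inl j)
  adj-inl i j rewrite splitAt-↑ˡ (n G) i (n H) | splitAt-↑ˡ (n G) j (n H) = refl

  adj-inr : ∀ i j → adj H i j ≡ adj (G ⊕ H) (inr i) (inr j)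
  adj-inr i j rewrite splitAt-↑ʳ (n G) (n H) i | splitAt-↑ʳ (n G) (n H) j = refl

  adj-inl-inr : ∀ i j → adj (G ⊕ H) (inl i) (inr j) ≡ false
  adj-inl-inr i j rewrite splitAt-↑ˡ (n G) i (n H) | splitAt-↑ʳ (n G) (n H) j = refl

  ⊕-inducedˡ : IsInduced G (G ⊕ H) (⊤ {n G} ++ ⊥ {n H})
  ⊕-inducedˡ = inl , ↑ˡ-injective (n H) _ _ , (λ i → ∈-++ˡ⁺ ∈⊤) , onto , adj-inl
    where
    onto : ∀ v → v ∈ ⊤ {n G} ++ ⊥ {n H} → ∃ λ i → inl i ≡ v
    onto v v∈ with split (n G) (n H) v
    ... | left i = i , refl
    ... | right j = ⊥-elim (∉⊥ (∈-++ʳ⁻ (⊤ {n G}) v∈))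

  ⊕-inducedʳ : IsInduced H (G ⊕ H) (⊥ {n G} ++ ⊤ {n H})
  ⊕-inducedʳ = inr , ↑ʳ-injective (n G) _ _ , (λ j → ∈-++ʳ⁺ (⊥ {n G}) ∈⊤) , onto , adj-inr
    where
    onto : ∀ v → v ∈ ⊥ {n G} ++ ⊤ {n H} → ∃ λ j → inr j ≡ v
    onto v v∈ with split (n G) (n H) v
    ... | left i = ⊥-elim (∉⊥ (∈-++ˡ⁻ v∈))
    ... | right j = j , refl

  ⊕-closedˡ : ClosedUnderAdj (G ⊕ H) (⊤ {n G} ++ ⊥ {n H})
  ⊕-closedˡ u v u∈ e with split (n G) (n H) u | split (n G) (n H) v
  ... | _ | left j = ∈-++ˡ⁺ ∈⊤
  ... | right i | right j = ⊥-elim (∉⊥ (∈-++ʳ⁻ (⊤ {n G}) u∈))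
  ... | left i | right j = contradiction (trans (≡-sym e) (adj-inl-inr i j)) λ ()

  ⊕-closedʳ : ClosedUnderAdj (G ⊕ H) (⊥ {n G} ++ ⊤ {n H})
  ⊕-closedʳ u v u∈ e with split (n G) (n H) u | split (n G) (n H) v
  ... | _ | right j = ∈-++ʳ⁺ (⊥ {n G}) ∈⊤
  ... | left i | left j = ⊥-elim (∉⊥ (∈-++ˡ⁻ u∈))
  ... | right i | left j = contradiction (trans (≡-sym (Edge-sym (G ⊕ H) e)) (adj-inl-inr j i)) λ ()

  IsVC-⊕ : ∀ {S T} → IsVC G S → IsVC H T → IsVC (G ⊕ H) (S ++ T)
  IsVC-⊕ {S} vcS vcT u v e with split (n G) (n H) u | split (n G) (n H) v
  ... | left i | left j = Sum.map ∈-++ˡ⁺ ∈-++ˡ⁺ (vcS i j (trans (adj-inl i j) e))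
  ... | right i | right j = Sum.map (∈-++ʳ⁺ S) (∈-++ʳ⁺ S) (vcT i j (trans (adj-inr i j) e))
  ... | left i | right j = contradiction (trans (≡-sym e) (adj-inl-inr i j)) λ ()
  ... | right i | left j = contradiction (trans (≡-sym (Edge-sym (G ⊕ H) e)) (adj-inl-inr j i)) λ ()

  IsVC-⊕ˡ⁻ : ∀ {S T} → IsVC (G ⊕ H) (S ++ T) → IsVC G S
  IsVC-⊕ˡ⁻ vc i j e = Sum.map ∈-++ˡ⁻ ∈-++ˡ⁻ (vc (inl i) (inl j) (trans (≡-sym (adj-inl i j)) e))

  IsVC-⊕ʳ⁻ : ∀ {S T} → IsVC (G ⊕ H) (S ++ T) → IsVC H T
  IsVC-⊕ʳ⁻ {S} vc i j e =
    Sum.map (∈-++ʳ⁻ S) (∈-++ʳ⁻ S) (vc (inr i) (inr j) (trans (≡-sym (adj-inr i j)) e))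

Reach-closed : ∀ {G S u v} → ClosedUnderAdj G S → Reach G u v → u ∈ S → v ∈ S
Reach-closed closed here u∈S = u∈S
Reach-closed closed (step e p) u∈S = Reach-closed closed p (closed _ _ u∈S e)

component-unique : ∀ {G S R x} → IsComponent G S → ClosedUnderAdj G R →
  (∀ u v → u ∈ R → v ∈ R → Reach G u v) → x ∈ S → x ∈ R → S ≡ R
component-unique (_ , closedS , reachS) closedR reachR x∈S x∈R = ⊆-antisym
  (λ y∈S → Reach-closed closedR (reachS _ _ x∈S y∈S) x∈R)
  (λ y∈R → Reach-closed closedS (reachR _ _ x∈R y∈R) x∈S)

Reach-induced : ∀ {H G S} → IsInduced H G S → (∀ i j → Reach H i j) →
  ∀ u v → u ∈ S → v ∈ S → Reach G u v
Reach-induced (f , _ , _ , f-onto , f-adj) reach u v u∈S v∈S with f-onto u u∈S | f-onto v v∈S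
... | i , refl | j , refl = Reach-map f (λ {i} {j} e → trans (≡-sym (f-adj i j)) e) (reach i j)

-- Both summands are connected, so they are the only components of the disconnected sum and no
-- further deletion is spent.
EdLe-⊕ : ∀ {C d G H} → IsoClosed C → Connected G → Connected H → EdLe C d G → EdLe C d H →
  EdLe C d (G ⊕ H)
EdLe-⊕ {C} {d} {G} {H} iso (1≤G , reachG) (1≤H , reachH) edG edH =
  comps (≤-trans 1≤G (m≤m+n (n G) (n H))) ¬conn parts
  where
  ¬conn : ¬ Connected (G ⊕ H)
  ¬conn (_ , reach) = ∉⊥ (∈-++ʳ⁻ (⊤ {n G}) (Reach-closed (⊕-closedˡ G H)
    (reach (fromℕ< 1≤G ↑ˡ n H) (n G ↑ʳ fromℕ< 1≤H)) (∈-++ˡ⁺ ∈⊤)))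
  whole : ∀ {K L R S} → EdLe C d L → (indL : IsInduced L (G ⊕ H) R) → S ≡ R →
    IsInduced K (G ⊕ H) S → EdLe C d K
  whole {K} {L} {R} ed indL refl indK = EdLe-iso iso
    (subst (IsInduced K L) (⊆-antisym ⊆⊤ λ {i} _ → ∈-⁻¹⁺ (proj₁ indL) (proj₁ (proj₂ (proj₂ indL)) i))
      (IsInduced-factor {K} {G ⊕ H} {L} indL indK λ x∈ → x∈)) ed
  parts : ∀ S → IsComponent (G ⊕ H) S → ∀ K → IsInduced K (G ⊕ H) S → EdLe C d K
  parts S comp@((x , x∈S) , _) K indK with split (n G) (n H) x
  ... | left i = whole edG (⊕-inducedˡ G H) (component-unique comp (⊕-closedˡ G H)
    (Reach-induced (⊕-inducedˡ G H) reachG) x∈S (∈-++ˡ⁺ ∈⊤)) indK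
  ... | right j = whole edH (⊕-inducedʳ G H) (component-unique comp (⊕-closedʳ G H)
    (Reach-induced (⊕-inducedʳ G H) reachH) x∈S (∈-++ʳ⁺ (⊥ {n G}) ∈⊤)) indK

-- Adding an apex vertex

coneAdj : (H : Graph) → Subset (n H) → Fin (suc (n H)) → Fin (suc (n H)) → Bool
coneAdj H M zero zero = false
coneAdj H M zero (suc j) = lookup M j
coneAdj H M (suc i) zero = lookup M i
coneAdj H M (suc i) (suc j) = adj H i j

cone : (H : Graph) → Subset (n H) → Graph
cone H M = record
  { n = suc (n H)
  ; adj = coneAdj H M
  ; sym = λ where
      zero zero → refl
      zero (suc j) → refl
      (suc i) zero → refl
      (suc i) (suc j) → sym H i j
  ; irrefl = λ where
      zero → refl
      (suc i) → irrefl H i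
  }

module _ (H : Graph) (M : Subset (n H)) where

  cone-induced : IsInduced H (cone H M) (∁ ⁅ zero ⁆)
  cone-induced = suc , suc-injective , (λ i → x∉p⇒x∈∁p {p = ⁅ zero ⁆} λ { (there x∈) → ∉⊥ x∈ }) , onto , λ _ _ → refl
    where
    onto : ∀ v → v ∈ ∁ ⁅ zero ⁆ → ∃ λ i → suc i ≡ v
    onto zero v∈ = ⊥-elim (x∈∁p⇒x∉p v∈ (x∈⁅x⁆ zero))
    onto (suc i) _ = i , refl

  IsVC-cone-in : ∀ {T} → IsVC H T → IsVC (cone H M) (inside ∷ T)
  IsVC-cone-in vc zero v e = inj₁ here
  IsVC-cone-in vc (suc u) zero e = inj₂ here
  IsVC-cone-in vc (suc u) (suc v) e = Sum.map there there (vc u v e)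

  IsVC-cone-out : ∀ {T} → IsVC H T → M ⊆ T → IsVC (cone H M) (outside ∷ T)
  IsVC-cone-out vc M⊆T zero (suc v) e = inj₂ (there (M⊆T (lookup⇒[]= v M e)))
  IsVC-cone-out vc M⊆T (suc u) zero e = inj₁ (there (M⊆T (lookup⇒[]= u M e)))
  IsVC-cone-out vc M⊆T (suc u) (suc v) e = Sum.map there there (vc u v e)

  IsVC-cone⁻ : ∀ {t T} → IsVC (cone H M) (t ∷ T) → IsVC H T
  IsVC-cone⁻ vc u v e = Sum.map drop-there drop-there (vc (suc u) (suc v) e)

  cone-out⁻ : ∀ {T} → IsVC (cone H M) (outside ∷ T) → M ⊆ T
  cone-out⁻ vc {x} x∈M with vc zero (suc x) ([]=⇒lookup x∈M)
  ... | inj₂ (there x∈T) = x∈T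

  cone-connected : (∀ x → ∃ λ y → y ∈ M × Reach H y x) → Connected (cone H M)
  cone-connected hub = s≤s z≤n , λ u v → Reach-trans (Reach-sym (from-apex u)) (from-apex v)
    where
    from-apex : ∀ v → Reach (cone H M) zero v
    from-apex zero = here
    from-apex (suc x) = let y , y∈M , path = hub x in
      step ([]=⇒lookup y∈M) (Reach-map suc id path)

-- The lower bound

-- Connectedness is kept because it makes the two copies the components of their union and keeps the
-- apex construction connected. The index j is one less than the blocker's size, since this is the
-- number that doubles.
record Witness (C : GraphClass) (d j : ℕ) : Set where
  field
    graph     : Graph
    connected : Connected graph
    ed        : EdLe C d graph
    opt       : ℕ
    opt-lower : Forces graph ⊥ opt
    blocker   : Subset (n graph)
    critical  : Critical graph ⊥ blocker opt
    size      : ∣ blocker ∣ ≡ suc j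

∣∣>0⇒Nonempty : ∀ {m} {p : Subset m} {j} → ∣ p ∣ ≡ suc j → Nonempty p
∣∣>0⇒Nonempty {p = inside ∷ p} _ = zero , here
∣∣>0⇒Nonempty {p = outside ∷ p} eq = let x , x∈p = ∣∣>0⇒Nonempty {p = p} eq in suc x , there x∈p

Witness⇒BetaAttained : ∀ {C d j} → Witness C d j →
  Σ Graph λ G → EdLe C d G × BetaAttained G (suc j)
Witness⇒BetaAttained w =
  -- Tightness at an element of the blocker yields a cover of size `opt`, so this lower bound is the
  -- optimum.
  let z , z∈Z = ∣∣>0⇒Nonempty size
      T , vc , _ , T≤ = critical-tight critical z∈Z
  in graph , ed , blocker
   , critical⇒minimalBlocking opt-lower (T , vc , ⊥⊆ , T≤) critical , size
  where
  open Witness w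

-- Two copies A, B of G and an apex v joined to Z in A and to a single z of Z in B;
-- the critical set is Z in A together with Z - z in B. Covers using v pay extra for
-- Z in A; covers avoiding v contain z in B, hence pay extra in both copies.
module Doubling (G : Graph) {Z : Subset (n G)} {m : ℕ} (fm : Forces G ⊥ m)
                (crit : Critical G ⊥ Z m) {z : V G} (z∈Z : z ∈ Z) where

  apexNbrs : Subset (n (G ⊕ G))
  apexNbrs = Z ++ ⁅ z ⁆

  doubled : Graph
  doubled = cone (G ⊕ G) apexNbrs

  Y : Subset (n doubled)
  Y = outside ∷ (Z ++ (Z - z))

  -- One optimum per copy plus one more vertex: either the apex is taken, or the first copy contains
  -- all of Z.
  opt : ℕ
  opt = suc (m + m)

  ∣Y∣ : ∀ {j} → ∣ Z ∣ ≡ suc j → ∣ Y ∣ ≡ suc (j + j)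
  ∣Y∣ eq = trans (∣++∣ Z (Z - z))
    (cong₂ _+_ eq (cong pred (trans (x∈p⇒1+∣p-x∣≡∣p∣ z∈Z) eq)))

  private
    fZ : ∀ {T} → IsVC G T → Z ⊆ T → suc m ≤ ∣ T ∣
    fZ vc Z⊆T = Critical.forces crit _ vc (∪-lub ⊥⊆ (λ {x} → Z⊆T {x}))

    f⊥ : ∀ {T} → IsVC G T → m ≤ ∣ T ∣
    f⊥ vc = fm _ vc ⊥⊆

    tight : ∀ {y} → y ∈ Z → CoverWithin G (Z - y) m
    tight y∈Z = let T , vc , ⊆T , T≤m = critical-tight crit y∈Z in T , vc , ⊆T ∘ ∈-∪ʳ , T≤m

    ≤∣++∣ : ∀ {k} (S T : Subset (n G)) → k ≤ ∣ S ∣ + ∣ T ∣ → k ≤ ∣ S ++ T ∣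
    ≤∣++∣ S T k≤ = ≤-trans k≤ (≤-reflexive (≡-sym (∣++∣ S T)))

    ∣++∣≤ : ∀ {k} (S T : Subset (n G)) → ∣ S ∣ + ∣ T ∣ ≤ k → ∣ S ++ T ∣ ≤ k
    ∣++∣≤ S T ≤k = ≤-trans (≤-reflexive (∣++∣ S T)) ≤k

    restore : ∀ {T y} → Z - y ⊆ T → y ∈ T → Z ⊆ T
    restore {y = y} Z-y⊆T y∈T {x} x∈Z with x ≟ᶠ y
    ... | yes refl = y∈T
    ... | no x≢y = Z-y⊆T (x∈p∧x≢y⇒x∈p-y x∈Z x≢y)

    module Cover {t} (S T : Subset (n G)) (vc : IsVC doubled (t ∷ (S ++ T))) where
      vcS : IsVC G S
      vcS = IsVC-⊕ˡ⁻ G G (IsVC-cone⁻ (G ⊕ G) apexNbrs vc)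
      vcT : IsVC G T
      vcT = IsVC-⊕ʳ⁻ G G {S} (IsVC-cone⁻ (G ⊕ G) apexNbrs vc)

    module CoverOut (S T : Subset (n G)) (vc : IsVC doubled (outside ∷ (S ++ T))) where
      Z⊆S : Z ⊆ S
      Z⊆S x∈Z = ∈-++ˡ⁻ {q = T} (cone-out⁻ (G ⊕ G) apexNbrs vc (∈-++ˡ⁺ x∈Z))
      z∈T : z ∈ T
      z∈T = ∈-++ʳ⁻ S (cone-out⁻ (G ⊕ G) apexNbrs vc (∈-++ʳ⁺ Z (x∈⁅x⁆ z)))

  opt-lower : Forces doubled ⊥ opt
  opt-lower (t ∷ U) vc _ with Vec.splitAt (n G) U
  opt-lower (inside ∷ .(S ++ T)) vc _ | S , T , refl =
    s≤s (≤∣++∣ S T (+-mono-≤ (f⊥ vcS) (f⊥ vcT)))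
    where
    open Cover S T vc
  opt-lower (outside ∷ .(S ++ T)) vc _ | S , T , refl =
    ≤∣++∣ S T (+-mono-≤ (fZ vcS Z⊆S) (f⊥ vcT))
    where
    open Cover S T vc
    open CoverOut S T vc

  Y-forces : Forces doubled Y (suc opt)
  Y-forces (t ∷ U) vc _ with Vec.splitAt (n G) U
  Y-forces (inside ∷ .(S ++ T)) vc Y⊆ | S , T , refl =
    s≤s (≤∣++∣ S T (+-mono-≤ (fZ vcS Z⊆S) (f⊥ vcT)))
    where
    open Cover S T vc
    Z⊆S : Z ⊆ S
    Z⊆S x∈Z = ∈-++ˡ⁻ {q = T} (drop-there (Y⊆ (there (∈-++ˡ⁺ x∈Z))))
  Y-forces (outside ∷ .(S ++ T)) vc Y⊆ | S , T , refl =
    ≤∣++∣ S T (≤-trans (≤-reflexive (cong suc (≡-sym (+-suc m m))))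
      (+-mono-≤ (fZ vcS Z⊆S) (fZ vcT (restore Z-z⊆T z∈T))))
    where
    open Cover S T vc
    open CoverOut S T vc
    Z-z⊆T : Z - z ⊆ T
    Z-z⊆T x∈ = ∈-++ʳ⁻ S (drop-there (Y⊆ (there (∈-++ʳ⁺ Z x∈))))

  Y-tight : ∀ {y} → y ∈ Y → CoverWithin doubled (Y - y) opt
  Y-tight {suc u} (there u∈) with split (n G) (n G) u
  ... | left y with tight (∈-++ˡ⁻ u∈) | tight z∈Z
  ...   | S , vcS , ⊆S , S≤m | T , vcT , ⊆T , T≤m =
    -- Without y in the first copy, taking the apex leaves an optimal cover in each copy: one tight
    -- at y, one tight at z.
    inside ∷ (S ++ T) , IsVC-cone-in (G ⊕ G) apexNbrs (IsVC-⊕ G G vcS vcT) , sub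
    , s≤s (∣++∣≤ S T (+-mono-≤ S≤m T≤m))
    where
    sub : Y - suc (y ↑ˡ n G) ⊆ inside ∷ (S ++ T)
    sub {zero} _ = here
    sub {suc x} x∈ with split (n G) (n G) x
    ... | left i = there (∈-++ˡ⁺ (⊆S (x∈p∧x≢y⇒x∈p-y
      (∈-++ˡ⁻ (drop-there (p─q⊆p Y ⁅ suc (y ↑ˡ n G) ⁆ x∈)))
      λ where refl → x∉p-x Y _ x∈)))
    ... | right j = there (∈-++ʳ⁺ S (⊆T (∈-++ʳ⁻ Z (drop-there (p─q⊆p Y ⁅ suc (y ↑ˡ n G) ⁆ x∈)))))
  Y-tight {suc u} (there u∈) | right y with tight z∈Z | tight (p─q⊆p Z ⁅ z ⁆ (∈-++ʳ⁻ Z u∈))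
  ...   | S , vcS , ⊆S , S≤m | T , vcT , ⊆T , T≤m =
    -- Without y in the second copy, the apex is avoided: the first copy pays m + 1 to contain Z,
    -- and the second uses a cover tight at y, which contains z because y differs from z.
    outside ∷ (S⁺ ++ T)
    , IsVC-cone-out (G ⊕ G) apexNbrs (IsVC-⊕ G G (IsVC-mono {G} ∈-∪ˡ vcS) vcT) (++-⊆ Z⊆S⁺ ⁅z⁆⊆T)
    , sub
    , ∣++∣≤ S⁺ T (+-mono-≤ (≤-trans (∣p∪⁅x⁆∣≤1+∣p∣ S z) (s≤s S≤m)) T≤m)
    where
    S⁺ = S ∪ ⁅ z ⁆
    Z⊆S⁺ : Z ⊆ S⁺
    Z⊆S⁺ = restore (∈-∪ˡ ∘ ⊆S) (∈-∪ʳ (x∈⁅x⁆ z))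
    ⁅z⁆⊆T : ⁅ z ⁆ ⊆ T
    ⁅z⁆⊆T x∈ rewrite x∈⁅y⁆⇒x≡y z x∈ =
      ⊆T (x∈p∧x≢y⇒x∈p-y z∈Z λ where refl → x∉p-x Z z (∈-++ʳ⁻ Z u∈))
    sub : Y - suc (n G ↑ʳ y) ⊆ outside ∷ (S⁺ ++ T)
    sub {zero} x∈ with p─q⊆p Y ⁅ suc (n G ↑ʳ y) ⁆ x∈
    ... | ()
    sub {suc x} x∈ with split (n G) (n G) x
    ... | left i = there (∈-++ˡ⁺ (Z⊆S⁺ (∈-++ˡ⁻ (drop-there (p─q⊆p Y ⁅ suc (n G ↑ʳ y) ⁆ x∈)))))
    ... | right j = there (∈-++ʳ⁺ S⁺ (⊆T (x∈p∧x≢y⇒x∈p-y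
      (p─q⊆p Z ⁅ z ⁆ (∈-++ʳ⁻ Z (drop-there (p─q⊆p Y ⁅ suc (n G ↑ʳ y) ⁆ x∈))))
      λ where refl → x∉p-x Y _ x∈)))

  Y-critical : Critical doubled ⊥ Y opt
  Y-critical = tight⇒critical {doubled} {⊥} (Forces-mono doubled {Y} ∈-∪ʳ Y-forces) λ y∈Y →
    let T , vc , ⊆T , T≤ = Y-tight y∈Y in T , vc , ∪-lub ⊥⊆ (λ {x} → ⊆T {x}) , T≤

  doubled-connected : Connected G → Connected doubled
  doubled-connected (_ , reach) = cone-connected (G ⊕ G) apexNbrs hub
    where
    hub : ∀ x → ∃ λ y → y ∈ apexNbrs × Reach (G ⊕ G) y x
    hub x with split (n G) (n G) x
    ... | left i = z ↑ˡ n G , ∈-++ˡ⁺ z∈Z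
      , Reach-map (_↑ˡ n G) (λ {i} {j} e → trans (≡-sym (adj-inl G G i j)) e) (reach z i)
    ... | right j = n G ↑ʳ z , ∈-++ʳ⁺ Z (x∈⁅x⁆ z)
      , Reach-map (n G ↑ʳ_) (λ {i} {j} e → trans (≡-sym (adj-inr G G i j)) e) (reach z j)

-- Iterated doubling and its starting graphs

module _ {C : GraphClass} (iso : IsoClosed C) (her : Hereditary C) where

  double : ∀ {d j} → Witness C d j → Witness C (suc d) (j + j)
  double w = record
    { graph = doubled
    ; connected = doubled-connected connected
    ; ed = del (doubled-connected connected) zero (graph ⊕ graph) (cone-induced (graph ⊕ graph) apexNbrs)
             (EdLe-⊕ iso connected connected ed ed)
    ; opt = D.opt
    ; opt-lower = D.opt-lower
    ; blocker = Y
    ; critical = Y-critical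
    ; size = ∣Y∣ size
    }
    where
    open Witness w
    module D = Doubling graph opt-lower critical (proj₂ (∣∣>0⇒Nonempty size))
    open D using (doubled; doubled-connected; apexNbrs; Y; Y-critical; ∣Y∣)

  doubles : ∀ {d j} → Witness C d j → ∀ e → Witness C (e + d) (j * 2 ^ e)
  doubles {d} {j} w zero = subst (Witness C d) (≡-sym (*-identityʳ j)) w
  doubles {d} {j} w (suc e) = subst (Witness C (suc e + d)) (j*p+j*p j (2 ^ e)) (double (doubles w e))

  -- Doubling starts from a connected graph, so the blocking set is moved to the one component
  -- containing it, which is an induced subgraph and thus still in the class.
  class-witness : ∀ {G j} → C G → BetaAttained G (suc j) → Witness C 0 j
  class-witness {G} cG (Z , blocking , size) with minimalBlocking⇒critical blocking | ∣∣>0⇒Nonempty size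
  ... | m , fm , crit | z , z∈Z with component G z
  ... | K , z∈K , comp@(_ , closed , reach)
    with critical⊆closed G closed fm crit z∈Z z∈K
  ... | Z⊆K with critical-localise G closed fm crit z∈Z Z⊆K
  ... | c , fc , crit′ = record
    { graph = H
    ; connected = ≤-trans (≤-reflexive (≡-sym (∣⁅x⁆∣≡1 z))) (p⊆q⇒∣p∣≤∣q∣ ⁅z⁆⊆K)
                , λ i j → Reach-restrict ind closed (reach _ _ (enum-∈ K i) (enum-∈ K j)) i j refl refl
    ; ed = base (hereditary-induced iso her cG ind)
    ; opt = c
    ; opt-lower = Forces-restrict {H} {G} ind {⊥ ∪ ∁ K} (λ i∈ → ⊥-elim (empty (_ , i∈))) fc
    ; blocker = enum K ⁻¹[ Z ]
    ; critical = critical-restrict {H} {G} ind ∈-∪ʳ empty crit′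
    ; size = trans (∣⁻¹∣≡ {H} {G} ind Z⊆K) size
    }
    where
    H = induced G K
    ind = induced-isInduced G K
    ⁅z⁆⊆K : ⁅ z ⁆ ⊆ K
    ⁅z⁆⊆K x∈ rewrite x∈⁅y⁆⇒x≡y z x∈ = z∈K
    empty : Empty (enum K ⁻¹[ ⊥ ∪ ∁ K ])
    empty (i , i∈) = x∈∁p⇒x∉p (∪-lub ⊥⊆ (λ x∈ → x∈) (∈-⁻¹⁻ (enum K) i∈)) (enum-∈ K i)

  -- A single vertex of G induces a one-vertex graph in the class, so an edge is one deletion away
  -- from it. Its two ends form a minimal blocking set of size 2.
  edge-witness : ∀ {G} → C G → V G → Witness C 1 1
  edge-witness {G} cG v = record
    { graph = K₂
    ; connected = K₂-connected
    ; ed = del K₂-connected zero K₁ (cone-induced K₁ ⊤) (base (hereditary-induced iso her cG K₁-induced))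
    ; opt = 1
    ; opt-lower = opt-lower
    ; blocker = ⊤
    ; critical = tight⇒critical {K₂} {⊥} {⊤} forces tight
    ; size = refl
    }
    where
    K₁ : Graph
    K₁ = record { n = 1 ; adj = λ _ _ → false ; sym = λ _ _ → refl ; irrefl = λ _ → refl }
    K₂ : Graph
    K₂ = cone K₁ ⊤
    K₁-induced : IsInduced K₁ G ⁅ v ⁆
    K₁-induced = (λ _ → v) , (λ { {zero} {zero} _ → refl }) , (λ _ → x∈⁅x⁆ v)
      , (λ u u∈ → zero , ≡-sym (x∈⁅y⁆⇒x≡y v u∈)) , λ _ _ → ≡-sym (irrefl G v)
    K₂-connected : Connected K₂
    K₂-connected = cone-connected K₁ ⊤ λ x → x , ∈⊤ , here
    opt-lower : Forces K₂ ⊥ 1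
    opt-lower (inside ∷ _) vc _ = s≤s z≤n
    opt-lower (outside ∷ inside ∷ []) vc _ = s≤s z≤n
    opt-lower (outside ∷ outside ∷ []) vc _ with vc zero (suc zero) refl
    ... | inj₁ ()
    ... | inj₂ (there ())
    forces : Forces K₂ (⊥ ∪ ⊤) 2
    forces T vc ⊤⊆T = p⊆q⇒∣p∣≤∣q∣ {p = ⊤ {2}} ⊤⊆T
    tight : ∀ {y} → y ∈ ⊤ {2} → CoverWithin K₂ (⊥ ∪ (⊤ - y)) 1
    tight {zero} _ = outside ∷ inside ∷ [] , IsVC-cone-out K₁ ⊤ (λ _ _ ()) (λ x∈ → x∈) , (λ x∈ → x∈) , ≤-refl
    tight {suc zero} _ = inside ∷ outside ∷ [] , IsVC-cone-in K₁ ⊤ (λ _ _ ()) , (λ x∈ → x∈) , ≤-refl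

theorem4 : (C : GraphClass) → IsoClosed C → Robust C → Hereditary C →
    (b : ℕ) → ClassBetaIs C b → (d : ℕ) → 1 ≤ d →
    (b ≡ 1 → EdBetaIs C d (2 ^ (d ∸ 1) + 1))
    × (2 ≤ b → EdBetaIs C d ((b ∸ 1) * 2 ^ d + 1))
theorem4 C iso _ her b (β≤ , attained) (suc e) _ = one attained , many attained
  where
  upper : ∀ {k} → bumps b (suc e) ≡ k → ∀ G → EdLe C (suc e) G → BetaLe G k
  upper eq G edG = subst (BetaLe G) eq (EdLe-BetaLe iso her β≤ edG)

  AttainedAt : ℕ → ℕ → Set
  AttainedAt d k = Σ Graph λ G → EdLe C d G × BetaAttained G k

  one : (b ≡ 0 ⊎ Σ Graph λ G → C G × BetaAttained G b) → b ≡ 1 → EdBetaIs C (suc e) (2 ^ e + 1)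
  one (inj₁ refl) ()
  one (inj₂ (G , cG , Y , _ , size)) refl =
    upper (trans (bumps-one e) (trans (bumps-suc 1 e (s≤s z≤n)) eq))
    , inj₂ (subst₂ AttainedAt (+-comm e 1) eq (Witness⇒BetaAttained
        -- A graph attaining β = 1 has a vertex because its blocking set is nonempty. The edge uses
        -- up one deletion, leaving e doublings.
        (doubles iso her (edge-witness iso her cG (proj₁ (∣∣>0⇒Nonempty {p = Y} size))) e)))
    where
    eq : suc (1 * 2 ^ e) ≡ 2 ^ e + 1
    eq = trans (cong suc (*-identityˡ (2 ^ e))) (+-comm 1 (2 ^ e))

  many : (b ≡ 0 ⊎ Σ Graph λ G → C G × BetaAttained G b) → 2 ≤ b →
    EdBetaIs C (suc e) ((b ∸ 1) * 2 ^ suc e + 1)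
  many (inj₁ refl) ()
  many (inj₂ (G , cG , attainedG)) (s≤s {n = j} 1≤j) =
    upper (trans (bumps-suc j (suc e) 1≤j) eq)
    , inj₂ (subst₂ AttainedAt (+-identityʳ (suc e)) eq (Witness⇒BetaAttained
        -- The starting graph has distance 0, so all `suc e` deletions are doublings.
        (doubles iso her (class-witness iso her cG attainedG) (suc e))))
    where
    eq : suc (j * 2 ^ suc e) ≡ j * 2 ^ suc e + 1
    eq = +-comm 1 (j * 2 ^ suc e)
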